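{- Let $G$ be a simple connected undirected graph of order $n\ge 2$ that is $r$-regular and $k$-resistance regular, and let $\rho_1(G)\ge\rho_2(G)\ge\cdots\ge\rho_n(G)$ be the eigenvalues, counted with multiplicity, of its resistance distance matrix. Then the eigenvalues, counted with multiplicity, of the resistance distance matrix of the double graph $D_2G$ are: $\frac{\rho_1(G)}{2}+\frac nr$ (once); $\frac{\rho_i(G)}{2}$ (once for each $i=2,\dots,n$); and $-\frac1r$ ($n$ times).
   Context: For a connected graph $G$ with vertices $v_1,\dots,v_n$, Laplacian matrix $L$ (degree matrix minus adjacency matrix) and Moore-Penrose inverse $L^\dagger=(l^\dagger_{ij})$, the resistance distance is $r_{ij}=l^\dagger_{ii}+l^\dagger_{jj}-2l^\dagger_{ij}$, and the resistance distance matrix is $R(G)=(r_{ij})$. $G$ is $k$-resistance regular if every row sum of $R(G)$ equals $k$; it is $r$-regular if every vertex has degree $r$. The double graph $D_2G$ of a graph $G$ with vertices $v_1,\dots,v_n$ is obtained by taking $G$ together with another copy of $G$ on vertices $v_1',\dots,v_n'$ ($v_i'$ corresponding to $v_i$) and joining, for each $i$, $v_i'$ to every vertex in the neighborhood $N(v_i)$ of $v_i$ in $G$. -}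

module Defs where

open import Level using (_⊔_) renaming (suc to lsuc)
open import Algebra.Apartness.Bundles using (HeytingField; HeytingCommutativeRing)
open import Algebra.Bundles using (CommutativeRing; Semiring)
open import Data.Bool.Base using (Bool; true; false; T; if_then_else_)
open import Data.Fin.Base as Fin using (Fin; zero; suc; toℕ; splitAt)
open import Data.Fin.Properties using (_≟_)
open import Data.Fin.Subset using (Subset; ∣_∣)
open import Data.Nat.Base as ℕ using (ℕ; zero; suc; NonZero)
open import Data.Product.Base using (proj₁)
open import Data.Sum.Base using (_⊎_; inj₁; inj₂)
open import Data.Vec.Base using (tabulate)
open import Data.Vec.Functional using (Vector; removeAt; transpose)
open import Relation.Binary.Construct.Closure.ReflexiveTransitive using (Star; ε; _◅_)
open import Relation.Binary.Core using (Rel)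
open import Relation.Binary.PropositionalEquality.Core using (_≡_; refl)
open import Relation.Binary.Structures using (IsStrictPartialOrder)
open import Relation.Nullary.Decidable.Core using (does)
open import Relation.Nullary.Negation.Core using (¬_)

------------------------------------------------------------------------
-- Graphs

record Graph (n : ℕ) : Set where
  field
    adj    : Fin n → Fin n → Bool
    sym    : ∀ i j → adj i j ≡ adj j i
    irrefl : ∀ i → adj i i ≡ false

  Adj : Rel (Fin n) _
  Adj i j = T (adj i j)

  N : Fin n → Subset n
  N i = tabulate (adj i)

  degree : Fin n → ℕ
  degree i = ∣ N i ∣

  Connected : Set
  Connected = ∀ i j → Star Adj i j

  Regular : ℕ → Set
  Regular r = ∀ i → degree i ≡ r

open Graph

-- In Fin (n + n) the first summand holds the vertices vᵢ and the second
-- one the vertices vᵢ′.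
doubleAdj : ∀ {n} → Graph n → Fin n ⊎ Fin n → Fin n ⊎ Fin n → Bool
doubleAdj G (inj₁ i) (inj₁ j) = adj G i j
doubleAdj G (inj₂ i) (inj₂ j) = adj G i j
doubleAdj G (inj₂ i) (inj₁ j) = adj G i j
doubleAdj G (inj₁ i) (inj₂ j) = adj G j i

D₂ : ∀ {n} → Graph n → Graph (n ℕ.+ n)
D₂ {n} G = record
  { adj    = λ p q → doubleAdj G (splitAt n p) (splitAt n q)
  ; sym    = λ p q → sym′ (splitAt n p) (splitAt n q)
  ; irrefl = λ p → irrefl′ (splitAt n p)
  }
  where
  sym′ : ∀ x y → doubleAdj G x y ≡ doubleAdj G y x
  sym′ (inj₁ i) (inj₁ j) = sym G i j
  sym′ (inj₁ i) (inj₂ j) = refl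
  sym′ (inj₂ i) (inj₁ j) = refl
  sym′ (inj₂ i) (inj₂ j) = sym G i j

  irrefl′ : ∀ x → doubleAdj G x x ≡ false
  irrefl′ (inj₁ i) = irrefl G i
  irrefl′ (inj₂ i) = irrefl G i

-- Needed to divide by r.
regular⇒nonZero : ∀ {m} (G : Graph (2 ℕ.+ m)) {r} →
                  Connected G → Regular G r → NonZero r
regular⇒nonZero G conn reg with conn zero (suc zero)
... | _◅_ {j = j} e _ with refl ← reg zero = card (adj G zero) j e
  where
  card : ∀ {n} (f : Fin n → Bool) (j : Fin n) → T (f j) → NonZero ∣ tabulate f ∣
  card f zero p with f zero
  ... | true = _
  card f (suc j) p with f zero
  ... | true  = _
  ... | false = card (λ i → f (suc i)) j p

------------------------------------------------------------------------
-- Ordered fields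

-- The reals are axiomatised as an ordered field; no completeness is
-- assumed.  The axioms are the constructive ones, so that both a field
-- with decidable order (the apartness then being the negation of _≈_)
-- and the constructive reals are models.
record OrderedField c ℓ₁ ℓ₂ : Set (lsuc (c ⊔ ℓ₁ ⊔ ℓ₂)) where
  infix 4 _<_ _≤_
  field
    heytingField : HeytingField c ℓ₁ ℓ₂

  open HeytingField heytingField public hiding (sym; refl; zero)
  open HeytingCommutativeRing heytingCommutativeRing public using (commutativeRing)

  field
    _<_                    : Rel Carrier ℓ₂
    <-isStrictPartialOrder : IsStrictPartialOrder _≈_ _<_
    <⇒#                    : ∀ {x y} → x < y → x # y
    #⇒<⊎>                  : ∀ {x y} → x # y → x < y ⊎ y < x
    +-monoˡ-<              : ∀ z {x y} → x < y → x + z < y + z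
    *-pos                  : ∀ {x y} → 0# < x → 0# < y → 0# < x * y
    0<1                    : 0# < 1#

  _≤_ : Rel Carrier ℓ₂
  x ≤ y = ¬ (y < x)

module Over {c ℓ₁ ℓ₂} (F : OrderedField c ℓ₁ ℓ₂) where

  open OrderedField F public
  private
    module CR = CommutativeRing commutativeRing
    module SPO = IsStrictPartialOrder <-isStrictPartialOrder

  open import Algebra.Definitions.RawSemiring (Semiring.rawSemiring CR.semiring) public
    using (_×_; _^_; sum; product)

  fromℕ : ℕ → Carrier
  fromℕ m = m × 1#

  0<fromℕ : ∀ m .{{_ : NonZero m}} → 0# < fromℕ m
  0<fromℕ (suc zero)    = SPO.<-respʳ-≈ (CR.sym (+-identityʳ 1#)) 0<1
  0<fromℕ (suc (suc m)) = SPO.trans (0<fromℕ (suc m))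
    (SPO.<-respˡ-≈ (+-identityˡ _) (+-monoˡ-< (fromℕ (suc m)) 0<1))

  -- #⇒invertible yields the inverse of fromℕ m - 0#, which is ≈ fromℕ m.
  infixl 7 _/_
  _/_ : Carrier → (m : ℕ) .{{_ : NonZero m}} → Carrier
  x / m = x * proj₁ (#⇒invertible (#-sym (<⇒# (0<fromℕ m))))

  ----------------------------------------------------------------------
  -- Matrices

  Matrix : ℕ → ℕ → Set c
  Matrix m n = Vector (Vector Carrier n) m

  infix 4 _≋_
  _≋_ : ∀ {m n} → Rel (Matrix m n) ℓ₁
  A ≋ B = ∀ i j → A i j ≈ B i j

  infixl 7 _⊗_
  _⊗_ : ∀ {l m n} → Matrix l m → Matrix m n → Matrix l n
  (A ⊗ B) i k = sum λ j → A i j * B j k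

  diagonal : ∀ {n} → Vector Carrier n → Matrix n n
  diagonal d i j = if does (i ≟ j) then d i else 0#

  -- Laplace expansion along the first row.
  det : ∀ {n} → Matrix n n → Carrier
  det {zero}  A = 1#
  det {suc n} A = sum λ j →
    (- 1#) ^ toℕ j * A zero j * det (λ i → removeAt (A (suc i)) j)

  charpoly : ∀ {n} → Matrix n n → Carrier → Carrier
  charpoly A x = det λ i j → diagonal (λ _ → x) i j - A i j

  -- The list ev consists of all the roots of the characteristic polynomial,
  -- each repeated according to its multiplicity.  An ordered field is
  -- infinite, so polynomials may be compared as functions.
  Eigenvalues : ∀ {n} → Matrix n n → Vector Carrier n → Set (c ⊔ ℓ₁)
  Eigenvalues A ev = ∀ x → charpoly A x ≈ product λ i → x - ev i

  Decreasing : ∀ {n} → Vector Carrier n → Set ℓ₂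
  Decreasing v = ∀ {i j} → i Fin.≤ j → v j ≤ v i

  record IsMoorePenrose {m n} (A : Matrix m n) (A† : Matrix n m) : Set ℓ₁ where
    field
      AA†A≋A     : A ⊗ A† ⊗ A ≋ A
      A†AA†≋A†   : A† ⊗ A ⊗ A† ≋ A†
      AA†-symm   : transpose (A ⊗ A†) ≋ A ⊗ A†
      A†A-symm   : transpose (A† ⊗ A) ≋ A† ⊗ A

  ----------------------------------------------------------------------
  -- Resistance distance

  adjacency : ∀ {n} → Graph n → Matrix n n
  adjacency G i j = if adj G i j then 1# else 0#

  laplacian : ∀ {n} → Graph n → Matrix n n
  laplacian G i j = diagonal (λ v → fromℕ (degree G v)) i j - adjacency G i j

  -- A Moore–Penrose inverse is unique when it exists, and that of the
  -- laplacian does exist for a connected graph; it is carried as a relation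
  -- because it is not a total computable operation on matrices over a field
  -- whose apartness is undecidable.
  record IsResistanceMatrix {n} (G : Graph n) (R : Matrix n n) : Set (c ⊔ ℓ₁) where
    field
      L†             : Matrix n n
      isMoorePenrose : IsMoorePenrose (laplacian G) L†
      resistance     : ∀ i j → R i j ≈ L† i i + L† j j - fromℕ 2 * L† i j

  -- k-resistance regularity of a graph whose resistance matrix is R.
  ResistanceRegular : ∀ {n} → Matrix n n → Carrier → Set ℓ₁
  ResistanceRegular R k = ∀ i → sum (R i) ≈ k

{-# OPTIONS --safe #-}
module Submission where

-- Equality in F is the complement of a tight apartness, so equations may be
-- proved by contradiction, and no decidability of the order is needed.
--
-- Put L for the Laplacian of G, h = 1/2, u = 1/r, and J for the all-ones
-- matrix.  Write T U V for the block matrix with U + V on the diagonal and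
-- U - V off it.  The Laplacian of the double graph is T L (rI)
-- (laplacian-D₂), products of such matrices are computed blockwise (T-⊗), so
-- its Moore-Penrose inverse is T (L†) (uI) / 4 (moorePenrose-T, with
-- moorePenrose-unique), and hence
--   R′ = T (R / 4 + (u / 2) J) (- (u / 2) I)        (resistance-D₂).
-- Row operations give det (T U (vI)) = (2v)^n det (2U) (det-T).  Therefore the
-- characteristic polynomial of R′ at x is (x + u)^n det (xI - R / 2 - uJ).
--
-- With the entries of ρ numbered from 0, it remains to find the eigenvalues
-- of R / 2 + uJ.  All column sums of 2xI - R - 2uJ are 2x - k - 2nu.  Adding
-- all the other rows to the first one, and clearing the multiples of the
-- all-ones row, shows that the determinant is this number times a cofactor
-- independent of the term 2uJ
-- (det-columnSums, det-onesRow-shift).  Since the characteristic polynomial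
-- of R is (x - k) times the same cofactor, the cofactor at x is the product of
-- the x - ρ i for i > 0, provided that ρ₀ = k (cofactor≈).  Dividing by x - k
-- is legitimate away from x = k, and a polynomial function that vanishes for
-- all large arguments vanishes everywhere (poly-vanish).
--
-- That ρ₀ = k is a Perron-Frobenius statement (ρ₀≈k).  If ρ₀ < k, then all
-- k - ρ i are positive, although k is a root of the characteristic
-- polynomial.  If k < ρ₀, then ρ₀I - R has positive row sums and nonpositive
-- entries off the diagonal, so that its determinant is positive (0<det),
-- although ρ₀ is a root.  The entries of R are nonnegative because L, and
-- with it L†, is positive semidefinite (resistance-nonneg).

open import Defs
open import Algebra.Bundles using (CommutativeMonoid; CommutativeRing)
import Algebra.Solver.Ring
open import Algebra.Solver.Ring.AlmostCommutativeRing
  using (fromCommutativeRing; _-Raw-AlmostCommutative⟶_)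
open import Data.Bool.Base using (Bool; true; false; if_then_else_)
open import Data.Fin.Base as Fin using (Fin; zero; suc; toℕ; punchIn; splitAt; _↑ˡ_; _↑ʳ_)
open import Data.Fin.Properties using (_≟_; splitAt-↑ˡ; splitAt-↑ʳ; ↑ˡ-injective; ↑ʳ-injective)
open import Data.Fin.Subset using (∣_∣)
open import Data.Integer.Base as ℤ using (ℤ; +_; -[1+_])
import Data.Integer.Properties as ℤ
open import Data.Maybe.Base using (Maybe) renaming (map to mapMaybe)
open import Data.Nat.Base as ℕ using (ℕ; zero; suc; NonZero; z≤n)
open import Data.Product.Base using (∃-syntax; _,_; proj₁; proj₂) renaming (_×_ to _∧_)
open import Data.Sign.Base as Sign using (Sign)
open import Data.Sum.Base using (inj₁; inj₂; [_,_]′)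
open import Data.Vec.Base using (tabulate)
open import Data.Vec.Functional using (Vector; _∷_; _++_; head; tail; map; replicate; transpose)
open import Data.Vec.Functional.Properties using (lookup-++ˡ; lookup-++ʳ)
open import Function.Base using (_∘_; id; const)
open import Level using (Level; _⊔_)
open import Relation.Binary.PropositionalEquality as ≡ using (_≡_; _≢_)
open import Relation.Binary.Structures using (IsStrictPartialOrder)
open import Relation.Nullary.Decidable using (does; yes; no; dec⇒maybe)
open import Relation.Nullary.Negation using (contradiction; ¬_)

-- Ring identities

-- The ring solver for an arbitrary commutative ring R, with coefficients in
-- the integers.  Their equality is decidable, so that terms cancel.
module IntegerCoefficients {c ℓ : Level} (R : CommutativeRing c ℓ) where

  open CommutativeRing R
  open import Algebra.Properties.Ring ring
  open import Algebra.Properties.Semiring.Mult semiring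
  open import Relation.Binary.Reasoning.Setoid setoid

  private
    fromSign : Sign → Carrier
    fromSign Sign.+ = 1#
    fromSign Sign.- = - 1#

    fromSign-* : ∀ s t → fromSign (s Sign.* t) ≈ fromSign s * fromSign t
    fromSign-* Sign.+ t      = sym (*-identityˡ _)
    fromSign-* Sign.- Sign.+ = sym (*-identityʳ _)
    fromSign-* Sign.- Sign.- = begin
      1#           ≈⟨ -‿involutive 1# ⟨
      - (- 1#)     ≈⟨ -1*x≈-x (- 1#) ⟨
      - 1# * - 1#  ∎

    -- The image of a natural number.  The clause for 1 makes the constant 1 of the solver mean 1# itself,
    -- and not 1# + 0#.
    nat : ℕ → Carrier
    nat 1 = 1#
    nat n = n × 1#

    nat≈× : ∀ n → nat n ≈ n × 1#
    nat≈× zero          = refl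
    nat≈× (suc zero)    = sym (+-identityʳ 1#)
    nat≈× (suc (suc n)) = refl

    -- The homomorphism from the integers to R.
    ⟦_⟧ : ℤ → Carrier
    ⟦ + n ⟧      = nat n
    ⟦ -[1+ n ] ⟧ = - nat (suc n)

    ⟦⟧-◃ : ∀ s n → ⟦ s ℤ.◃ n ⟧ ≈ fromSign s * (n × 1#)
    ⟦⟧-◃ s      zero    = sym (zeroʳ _)
    ⟦⟧-◃ Sign.+ (suc n) = trans (nat≈× (suc n)) (sym (*-identityˡ _))
    ⟦⟧-◃ Sign.- (suc n) = trans (-‿cong (nat≈× (suc n))) (sym (-1*x≈-x _))

    ⟦⟧-sign : ∀ i → ⟦ i ⟧ ≈ fromSign (ℤ.sign i) * (ℤ.∣ i ∣ × 1#)
    ⟦⟧-sign i = trans (reflexive (≡.cong ⟦_⟧ (≡.sym (ℤ.◃-inverse i)))) (⟦⟧-◃ (ℤ.sign i) ℤ.∣ i ∣)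

    interchange : ∀ a b x y → (a * b) * (x * y) ≈ (a * x) * (b * y)
    interchange a b x y = begin
      (a * b) * (x * y)  ≈⟨ *-assoc a b _ ⟩
      a * (b * (x * y))  ≈⟨ *-congˡ (*-assoc b x y) ⟨
      a * ((b * x) * y)  ≈⟨ *-congˡ (*-congʳ (*-comm b x)) ⟩
      a * ((x * b) * y)  ≈⟨ *-congˡ (*-assoc x b y) ⟩
      a * (x * (b * y))  ≈⟨ *-assoc a x _ ⟨
      (a * x) * (b * y)  ∎

    ⟦⟧-* : ∀ i j → ⟦ i ℤ.* j ⟧ ≈ ⟦ i ⟧ * ⟦ j ⟧
    ⟦⟧-* i j = begin
      ⟦ i ℤ.* j ⟧
        ≈⟨ ⟦⟧-◃ (ℤ.sign i Sign.* ℤ.sign j) (ℤ.∣ i ∣ ℕ.* ℤ.∣ j ∣) ⟩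
      fromSign (ℤ.sign i Sign.* ℤ.sign j) * ((ℤ.∣ i ∣ ℕ.* ℤ.∣ j ∣) × 1#)
        ≈⟨ *-cong (fromSign-* (ℤ.sign i) (ℤ.sign j)) (×1-homo-* ℤ.∣ i ∣ ℤ.∣ j ∣) ⟩
      (fromSign (ℤ.sign i) * fromSign (ℤ.sign j)) * ((ℤ.∣ i ∣ × 1#) * (ℤ.∣ j ∣ × 1#))
        ≈⟨ interchange _ _ _ _ ⟩
      (fromSign (ℤ.sign i) * (ℤ.∣ i ∣ × 1#)) * (fromSign (ℤ.sign j) * (ℤ.∣ j ∣ × 1#))
        ≈⟨ *-cong (⟦⟧-sign i) (⟦⟧-sign j) ⟨
      ⟦ i ⟧ * ⟦ j ⟧                                               ∎

    ⟦⟧-⊖ : ∀ m n → ⟦ m ℤ.⊖ n ⟧ ≈ m × 1# - n × 1#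
    ⟦⟧-⊖ m       zero    = trans (nat≈× m) (sym (trans (+-congˡ -0#≈0#) (+-identityʳ _)))
    ⟦⟧-⊖ zero    (suc n) = trans (-‿cong (nat≈× (suc n))) (sym (+-identityˡ _))
    ⟦⟧-⊖ (suc m) (suc n) = begin
      ⟦ suc m ℤ.⊖ suc n ⟧                    ≡⟨ ≡.cong ⟦_⟧ (ℤ.[1+m]⊖[1+n]≡m⊖n m n) ⟩
      ⟦ m ℤ.⊖ n ⟧                            ≈⟨ ⟦⟧-⊖ m n ⟩
      m × 1# - n × 1#                        ≈⟨ +-congʳ (xyx⁻¹≈y 1# (m × 1#)) ⟨
      (1# + m × 1# - 1#) - n × 1#            ≈⟨ +-assoc _ _ _ ⟩
      1# + m × 1# + (- 1# - n × 1#)          ≈⟨ +-congˡ (-‿+-comm 1# (n × 1#)) ⟩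
      1# + m × 1# - (1# + n × 1#)            ∎

    ⟦⟧-+ : ∀ i j → ⟦ i ℤ.+ j ⟧ ≈ ⟦ i ⟧ + ⟦ j ⟧
    ⟦⟧-+ (+ m)      (+ n)      = begin
      nat (m ℕ.+ n)     ≈⟨ nat≈× (m ℕ.+ n) ⟩
      (m ℕ.+ n) × 1#    ≈⟨ ×-homo-+ 1# m n ⟩
      m × 1# + n × 1#   ≈⟨ +-cong (nat≈× m) (nat≈× n) ⟨
      nat m + nat n     ∎
    ⟦⟧-+ (+ m)      -[1+ n ]   =
      trans (⟦⟧-⊖ m (suc n)) (sym (+-cong (nat≈× m) (-‿cong (nat≈× (suc n)))))
    ⟦⟧-+ -[1+ m ]   (+ n)      =
      trans (⟦⟧-⊖ n (suc m)) (trans (+-comm _ _)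
        (sym (+-cong (-‿cong (nat≈× (suc m))) (nat≈× n))))
    ⟦⟧-+ -[1+ m ]   -[1+ n ]   = begin
      - (suc (suc (m ℕ.+ n)) × 1#)       ≡⟨ ≡.cong (λ k → - (suc k × 1#)) (≡.sym (+-suc m n)) ⟩
      - ((suc m ℕ.+ suc n) × 1#)         ≈⟨ -‿cong (×-homo-+ 1# (suc m) (suc n)) ⟩
      - (suc m × 1# + suc n × 1#)        ≈⟨ -‿+-comm _ _ ⟨
      - (suc m × 1#) + - (suc n × 1#)
        ≈⟨ +-cong (-‿cong (nat≈× (suc m))) (-‿cong (nat≈× (suc n))) ⟨
      - nat (suc m) + - nat (suc n)      ∎
      where open import Data.Nat.Properties using (+-suc)

    ⟦⟧-neg : ∀ i → ⟦ ℤ.- i ⟧ ≈ - ⟦ i ⟧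
    ⟦⟧-neg (+ zero)  = sym -0#≈0#
    ⟦⟧-neg (+ suc n) = refl
    ⟦⟧-neg -[1+ n ]  = sym (-‿involutive _)

    homomorphism : CommutativeRing.rawRing ℤ.+-*-commutativeRing -Raw-AlmostCommutative⟶ fromCommutativeRing R
    homomorphism = record
      { ⟦_⟧ = ⟦_⟧ ; +-homo = ⟦⟧-+ ; *-homo = ⟦⟧-* ; -‿homo = ⟦⟧-neg
      ; 0-homo = refl ; 1-homo = refl }

    _≈?_ : ∀ i j → Maybe (⟦ i ⟧ ≈ ⟦ j ⟧)
    i ≈? j = mapMaybe (λ i≡j → reflexive (≡.cong ⟦_⟧ i≡j)) (dec⇒maybe (i ℤ.≟ j))

  open Algebra.Solver.Ring (CommutativeRing.rawRing ℤ.+-*-commutativeRing)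
    (fromCommutativeRing R) homomorphism _≈?_ public
    using (solve; _:=_; con; _:+_; _:*_; _:-_; :-_)

-- Sums and the identity matrix

module Base {c ℓ₁ ℓ₂ : Level} (F : OrderedField c ℓ₁ ℓ₂) where

  open Over F public
  open CommutativeRing commutativeRing public
    using (refl; sym; ring; semiring; +-commutativeMonoid; *-commutativeMonoid)
  open IntegerCoefficients commutativeRing public
  open import Algebra.Properties.Ring ring public
    using (-0#≈0#; -‿distribʳ-*; -‿+-comm)
  open import Algebra.Properties.Semiring.Sum semiring public
    using (sum-cong-≋; ∑-distrib-+; ∑-comm; *-distribˡ-sum; *-distribʳ-sum)
  open import Relation.Binary.Reasoning.Setoid setoid public

  sum-zero : ∀ {n} {f : Vector Carrier n} → (∀ i → f i ≈ 0#) → sum f ≈ 0#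
  sum-zero {zero}  f≈0 = refl
  sum-zero {suc n} f≈0 = trans (+-cong (f≈0 zero) (sum-zero (f≈0 ∘ suc))) (+-identityʳ 0#)

  sum-distrib-- : ∀ {n} (f g : Vector Carrier n) → sum (λ i → f i - g i) ≈ sum f - sum g
  sum-distrib-- {zero}  f g = sym (-‿inverseʳ 0#)
  sum-distrib-- {suc n} f g = trans (+-congˡ (sum-distrib-- (f ∘ suc) (g ∘ suc)))
    (solve 4 (λ x y s t → x :- y :+ (s :- t) := x :+ s :- (y :+ t)) refl
      (f zero) (g zero) (sum (f ∘ suc)) (sum (g ∘ suc)))

  -- The identity matrix.
  δ : ∀ {n} → Fin n → Fin n → Carrier
  δ i j = if does (i ≟ j) then 1# else 0#

  δ-refl : ∀ {n} (i : Fin n) → δ i i ≈ 1#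
  δ-refl i with i ≟ i
  ... | yes _   = refl
  ... | no  i≢i = contradiction ≡.refl i≢i

  δ-≢ : ∀ {n} {i j : Fin n} → i ≢ j → δ i j ≈ 0#
  δ-≢ {i = i} {j} i≢j with i ≟ j
  ... | yes i≡j = contradiction i≡j i≢j
  ... | no  _   = refl

  δ-sym : ∀ {n} (i j : Fin n) → δ i j ≈ δ j i
  δ-sym i j with i ≟ j
  ... | yes ≡.refl = sym (δ-refl i)
  ... | no  i≢j    = sym (δ-≢ (i≢j ∘ ≡.sym))

  sum-δ : ∀ {n} (i : Fin n) (f : Vector Carrier n) → sum (λ j → δ i j * f j) ≈ f i
  sum-δ {suc n} zero f = begin
    1# * f zero + sum (λ j → 0# * f (suc j))  ≈⟨ +-cong (*-identityˡ _) (sum-zero λ j → zeroˡ (f (suc j))) ⟩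
    f zero + 0#                               ≈⟨ +-identityʳ _ ⟩
    f zero                                    ∎
  sum-δ {suc n} (suc i) f = begin
    0# * f zero + sum (λ j → δ (suc i) (suc j) * f (suc j))
      ≈⟨ +-congʳ (zeroˡ _) ⟩
    0# + sum (λ j → δ i j * f (suc j))  ≈⟨ +-identityˡ _ ⟩
    sum (λ j → δ i j * f (suc j))       ≈⟨ sum-δ i (f ∘ suc) ⟩
    f (suc i)                           ∎

  diagonal≈ : ∀ {n} (d : Vector Carrier n) i j → diagonal d i j ≈ δ i j * d i
  diagonal≈ d i j with does (i ≟ j)
  ... | true  = sym (*-identityˡ _)
  ... | false = sym (zeroˡ _)

-- Determinants

module Determinants {c ℓ₁ ℓ₂ : Level} (F : OrderedField c ℓ₁ ℓ₂) where

  open Base F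

  det-cong : ∀ {n} {A B : Matrix n n} → A ≋ B → det A ≈ det B
  det-cong {zero}  A≋B = refl
  det-cong {suc n} A≋B = sum-cong-≋ λ j →
    *-cong (*-congˡ {x = (- 1#) ^ toℕ j} (A≋B zero j)) (det-cong λ i k → A≋B (suc i) (punchIn j k))

  private
    sign : ∀ {n} → Fin n → Carrier
    sign i = (- 1#) ^ toℕ i

    -- Minors along the first row and along the first column.
    rowMinor columnMinor : ∀ {n} → Matrix (suc n) (suc n) → Fin (suc n) → Matrix n n
    rowMinor    A j k l = A (suc k) (punchIn j l)
    columnMinor A i k l = A (punchIn i k) (suc l)

  -- Laplace expansion along the first column.  Expanding the minors of the
  -- expansion along the first row by induction, and those on the right-hand
  -- side by definition, leaves the same double sum on both sides.
  det-column : ∀ {n} (A : Matrix (suc n) (suc n)) →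
    det A ≈ sum λ i → (- 1#) ^ toℕ i * A i zero * det (λ k l → A (punchIn i k) (suc l))
  det-column {zero}  A = refl
  det-column {suc n} A = +-congˡ (begin
    sum (λ j → sign (suc j) * A zero (suc j) * det (rowMinor A (suc j)))
      ≈⟨ sum-cong-≋ (λ j → *-congˡ {x = sign (suc j) * A zero (suc j)} (det-column (rowMinor A (suc j)))) ⟩
    sum (λ j → sign (suc j) * A zero (suc j) * sum (λ i → sign i * A (suc i) zero * D i j))
      ≈⟨ sum-cong-≋ (λ j → *-distribˡ-sum (sign (suc j) * A zero (suc j)) (λ i → sign i * A (suc i) zero * D i j)) ⟩
    sum (λ j → sum (λ i → sign (suc j) * A zero (suc j) * (sign i * A (suc i) zero * D i j)))
      ≈⟨ ∑-comm (λ j i → sign (suc j) * A zero (suc j) * (sign i * A (suc i) zero * D i j)) ⟩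
    sum (λ i → sum (λ j → sign (suc j) * A zero (suc j) * (sign i * A (suc i) zero * D i j)))
      ≈⟨ sum-cong-≋ (λ i → sum-cong-≋ (λ j → exchange (sign j) (A zero (suc j)) (sign i) (A (suc i) zero) (D i j))) ⟩
    sum (λ i → sum (λ j → sign (suc i) * A (suc i) zero * (sign j * A zero (suc j) * D i j)))
      ≈⟨ sum-cong-≋ (λ i → *-distribˡ-sum (sign (suc i) * A (suc i) zero) (λ j → sign j * A zero (suc j) * D i j)) ⟨
    sum (λ i → sign (suc i) * A (suc i) zero * det (columnMinor A (suc i)))  ∎)
    where
    D : Fin (suc n) → Fin (suc n) → Carrier
    D i j = det (λ k l → A (suc (punchIn i k)) (suc (punchIn j l)))

    exchange : ∀ s a t b d → - 1# * s * a * (t * b * d) ≈ - 1# * t * b * (s * a * d)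
    exchange = solve 5 (λ s a t b d →
      :- con (+ 1) :* s :* a :* (t :* b :* d) := :- con (+ 1) :* t :* b :* (s :* a :* d)) refl

  -- Linearity in row p: the matrices A, B and C agree in all other rows.
  det-row-linear : ∀ {n} (p : Fin n) {A B C : Matrix n n} t →
    (∀ j → C p j ≈ A p j + t * B p j) →
    (∀ {i} → i ≢ p → ∀ j → A i j ≈ C i j) → (∀ {i} → i ≢ p → ∀ j → B i j ≈ C i j) →
    det C ≈ det A + t * det B
  det-row-linear {suc n} zero {A} {B} {C} t Cp A≈C B≈C = begin
    det C
      ≈⟨ sum-cong-≋ (λ j → begin
           sign j * C zero j * det (rowMinor C j)
             ≈⟨ *-congʳ (*-congˡ (Cp j)) ⟩
           sign j * (A zero j + t * B zero j) * det (rowMinor C j)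
             ≈⟨ split (sign j) (A zero j) t (B zero j) (det (rowMinor C j)) ⟩
           sign j * A zero j * det (rowMinor C j) + t * (sign j * B zero j * det (rowMinor C j))
             ≈⟨ +-cong (*-congˡ (det-cong λ k l → A≈C (λ ()) (punchIn j l)))
                       (*-congˡ (*-congˡ (det-cong λ k l → B≈C (λ ()) (punchIn j l)))) ⟨
           sign j * A zero j * det (rowMinor A j) + t * (sign j * B zero j * det (rowMinor B j))  ∎) ⟩
    sum (λ j → sign j * A zero j * det (rowMinor A j) + t * (sign j * B zero j * det (rowMinor B j)))
      ≈⟨ ∑-distrib-+ (λ j → sign j * A zero j * det (rowMinor A j)) (λ j → t * (sign j * B zero j * det (rowMinor B j))) ⟩
    det A + sum (λ j → t * (sign j * B zero j * det (rowMinor B j)))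
      ≈⟨ +-congˡ (*-distribˡ-sum t (λ j → sign j * B zero j * det (rowMinor B j))) ⟨
    det A + t * det B  ∎
    where
    split : ∀ s a t b d → s * (a + t * b) * d ≈ s * a * d + t * (s * b * d)
    split = solve 5 (λ s a t b d → s :* (a :+ t :* b) :* d := s :* a :* d :+ t :* (s :* b :* d)) refl
  det-row-linear {suc n} (suc p) {A} {B} {C} t Cp A≈C B≈C = begin
    det C
      ≈⟨ sum-cong-≋ (λ j → begin
           sign j * C zero j * det (rowMinor C j)
             ≈⟨ *-congˡ (det-row-linear p {rowMinor A j} {rowMinor B j} t (λ l → Cp (punchIn j l))
                   (λ i≢p l → A≈C (λ { ≡.refl → i≢p ≡.refl }) (punchIn j l))
                   (λ i≢p l → B≈C (λ { ≡.refl → i≢p ≡.refl }) (punchIn j l))) ⟩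
           sign j * C zero j * (det (rowMinor A j) + t * det (rowMinor B j))
             ≈⟨ split (sign j) (C zero j) t (det (rowMinor A j)) (det (rowMinor B j)) ⟩
           sign j * C zero j * det (rowMinor A j) + t * (sign j * C zero j * det (rowMinor B j))
             ≈⟨ +-cong (*-congʳ (*-congˡ (A≈C (λ ()) j))) (*-congˡ (*-congʳ (*-congˡ (B≈C (λ ()) j)))) ⟨
           sign j * A zero j * det (rowMinor A j) + t * (sign j * B zero j * det (rowMinor B j))  ∎) ⟩
    sum (λ j → sign j * A zero j * det (rowMinor A j) + t * (sign j * B zero j * det (rowMinor B j)))
      ≈⟨ ∑-distrib-+ (λ j → sign j * A zero j * det (rowMinor A j)) (λ j → t * (sign j * B zero j * det (rowMinor B j))) ⟩
    det A + sum (λ j → t * (sign j * B zero j * det (rowMinor B j)))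
      ≈⟨ +-congˡ (*-distribˡ-sum t (λ j → sign j * B zero j * det (rowMinor B j))) ⟨
    det A + t * det B  ∎
    where
    split : ∀ s c t a b → s * c * (a + t * b) ≈ s * c * a + t * (s * c * b)
    split = solve 5 (λ s c t a b → s :* c :* (a :+ t :* b) := s :* c :* a :+ t :* (s :* c :* b)) refl

  private
    -- Equal first two rows.  In the expansion along the first column, the first
    -- two terms cancel, and the minors of the others again begin with two
    -- equal rows.
    det-alternating₀₁ : ∀ {n} (A : Matrix (2 ℕ.+ n) (2 ℕ.+ n)) →
      (∀ j → A zero j ≈ A (suc zero) j) → det A ≈ 0#
    det-alternating₀₁ {n} A A₀≈A₁ = begin
      det A ≈⟨ det-column A ⟩
      sign {2 ℕ.+ n} zero * A zero zero * det (columnMinor A zero)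
        + (sign {2 ℕ.+ n} (suc zero) * A (suc zero) zero * det (columnMinor A (suc zero)) + rest)
          ≈⟨ +-cong (*-cong (*-congˡ (A₀≈A₁ zero)) (det-cong minors)) (+-congˡ (rest≈0 A A₀≈A₁)) ⟩
      1# * A (suc zero) zero * det (columnMinor A (suc zero))
        + (- 1# * 1# * A (suc zero) zero * det (columnMinor A (suc zero)) + 0#)
          ≈⟨ cancel (A (suc zero) zero) (det (columnMinor A (suc zero))) ⟩
      0# ∎
      where
      rest : Carrier
      rest = sum λ i → sign (suc (suc i)) * A (suc (suc i)) zero * det (columnMinor A (suc (suc i)))

      minors : columnMinor A zero ≋ columnMinor A (suc zero)
      minors zero    l = sym (A₀≈A₁ (suc l))
      minors (suc k) l = refl

      rest≈0 : ∀ {n} (A : Matrix (2 ℕ.+ n) (2 ℕ.+ n)) → (∀ j → A zero j ≈ A (suc zero) j) →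
        sum (λ i → sign (suc (suc i)) * A (suc (suc i)) zero * det (columnMinor A (suc (suc i)))) ≈ 0#
      rest≈0 {zero}  A A₀≈A₁ = refl
      rest≈0 {suc n} A A₀≈A₁ = sum-zero λ i →
        trans (*-congˡ {x = sign (suc (suc i)) * A (suc (suc i)) zero} (det-alternating₀₁ (columnMinor A (suc (suc i))) (A₀≈A₁ ∘ suc))) (zeroʳ _)

      cancel : ∀ a d → 1# * a * d + (- 1# * 1# * a * d + 0#) ≈ 0#
      cancel = solve 2 (λ a d → con (+ 1) :* a :* d :+ (:- con (+ 1) :* con (+ 1) :* a :* d :+ con (+ 0))
        := con (+ 0)) refl

    -- The determinant of an n by n matrix with two equal rows vanishes.
    Alternating : ℕ → Set _
    Alternating n = ∀ (A : Matrix n n) {p q} → p ≢ q → (∀ j → A p j ≈ A q j) → det A ≈ 0#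

    det-alternating-suc : ∀ {n} → Alternating n → (A : Matrix (suc n) (suc n)) → ∀ {p q} → p ≢ q →
      (∀ j → A (suc p) j ≈ A (suc q) j) → det A ≈ 0#
    det-alternating-suc alt A p≢q Ap≈Aq = sum-zero λ j →
      trans (*-congˡ {x = sign j * A zero j} (alt (rowMinor A j) p≢q (λ l → Ap≈Aq (punchIn j l)))) (zeroʳ _)

    -- Replacing the first two rows by x and y gives a bilinear form f x y that
    -- vanishes for x = y.  If u is the first row and v the second, then
    -- f v u = 0, because u occurs again below the first row.  Hence f u v = 0.
    det-alternating₀ : ∀ {n} → Alternating (suc n) → (A : Matrix (2 ℕ.+ n) (2 ℕ.+ n)) → ∀ q →
      (∀ j → A zero j ≈ A (suc (suc q)) j) → det A ≈ 0#
    det-alternating₀ {n} alt A q A₀≈Aq = begin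
      det A
        ≈⟨ det-cong {A = A} {B = M u v} (λ { zero j → refl ; (suc zero) j → refl ; (suc (suc i)) j → refl }) ⟩
      f u v                          ≈⟨ rearrange (f u v) (f v u) (f u u) (f v v) ⟩
      (f u u + 1# * f u v) + 1# * (f v u + 1# * f v v) - f u u - f v v - f v u
        ≈⟨ +-cong (+-cong (+-cong (sym expand) (-‿cong (same u))) (-‿cong (same v))) (-‿cong f-v-u) ⟩
      f w w - 0# - 0# - 0#           ≈⟨ +-congʳ (+-congʳ (+-congʳ (same w))) ⟩
      0# - 0# - 0# - 0#
        ≈⟨ solve 0 (con (+ 0) :- con (+ 0) :- con (+ 0) :- con (+ 0) := con (+ 0)) refl ⟩
      0#                             ∎
      where
      u v w : Vector Carrier (2 ℕ.+ n)
      u = A zero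
      v = A (suc zero)
      w j = u j + 1# * v j

      M : Vector Carrier (2 ℕ.+ n) → Vector Carrier (2 ℕ.+ n) → Matrix (2 ℕ.+ n) (2 ℕ.+ n)
      M x y zero          = x
      M x y (suc zero)    = y
      M x y (suc (suc i)) = A (suc (suc i))

      f : Vector Carrier (2 ℕ.+ n) → Vector Carrier (2 ℕ.+ n) → Carrier
      f x y = det (M x y)

      same : ∀ x → f x x ≈ 0#
      same x = det-alternating₀₁ (M x x) (λ j → refl)

      f-v-u : f v u ≈ 0#
      f-v-u = det-alternating-suc alt (M v u) {zero} {suc q} (λ ()) A₀≈Aq

      linear₀ : ∀ y → f w y ≈ f u y + 1# * f v y
      linear₀ y = det-row-linear zero {M u y} {M v y} {M w y} 1# (λ j → refl)
        (λ { {zero} i≢ j → contradiction ≡.refl i≢ ; {suc zero} _ j → refl ; {suc (suc i)} _ j → refl })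
        (λ { {zero} i≢ j → contradiction ≡.refl i≢ ; {suc zero} _ j → refl ; {suc (suc i)} _ j → refl })

      linear₁ : ∀ x → f x w ≈ f x u + 1# * f x v
      linear₁ x = det-row-linear (suc zero) {M x u} {M x v} {M x w} 1# (λ j → refl)
        (λ { {zero} _ j → refl ; {suc zero} i≢ j → contradiction ≡.refl i≢ ; {suc (suc i)} _ j → refl })
        (λ { {zero} _ j → refl ; {suc zero} i≢ j → contradiction ≡.refl i≢ ; {suc (suc i)} _ j → refl })

      expand : f w w ≈ (f u u + 1# * f u v) + 1# * (f v u + 1# * f v v)
      expand = trans (linear₀ w) (+-cong (linear₁ u) (*-congˡ (linear₁ v)))

      rearrange : ∀ uv vu uu vv → uv ≈ (uu + 1# * uv) + 1# * (vu + 1# * vv) - uu - vv - vu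
      rearrange = solve 4 (λ uv vu uu vv →
        uv := (uu :+ con (+ 1) :* uv) :+ con (+ 1) :* (vu :+ con (+ 1) :* vv) :- uu :- vv :- vu) refl

  det-alternating : ∀ {n} (A : Matrix n n) {p q} → p ≢ q → (∀ j → A p j ≈ A q j) → det A ≈ 0#
  det-alternating A {zero} {zero} p≢q Ap≈Aq = contradiction ≡.refl p≢q
  det-alternating {suc (suc n)} A {zero} {suc zero} p≢q Ap≈Aq = det-alternating₀₁ A Ap≈Aq
  det-alternating {suc (suc n)} A {zero} {suc (suc q)} p≢q Ap≈Aq = det-alternating₀ det-alternating A q Ap≈Aq
  det-alternating {suc (suc n)} A {suc zero} {zero} p≢q Ap≈Aq = det-alternating₀₁ A (sym ∘ Ap≈Aq)
  det-alternating {suc (suc n)} A {suc (suc p)} {zero} p≢q Ap≈Aq = det-alternating₀ det-alternating A p (sym ∘ Ap≈Aq)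
  det-alternating {suc n} A {suc p} {suc q} p≢q Ap≈Aq =
    det-alternating-suc det-alternating A (λ { ≡.refl → p≢q ≡.refl }) Ap≈Aq

  private
    -- C a i times row ι a is added to row i, for all a and i.
    addRows : ∀ {t n} (ι : Fin t → Fin n) (C : Fin t → Vector Carrier n) → Matrix n n → Matrix n n
    addRows ι C A i j = A i j + sum λ a → C a i * A (ι a) j

    -- The row p is added c times to row q only.
    det-addRow₁ : ∀ {n} (A : Matrix n n) {p q} c → p ≢ q →
      det (λ i j → A i j + c * δ q i * A p j) ≈ det A
    det-addRow₁ A {p} {q} c p≢q = begin
      det (λ i j → A i j + c * δ q i * A p j)
        ≈⟨ det-row-linear q {A} {B} c
             (λ j → +-congˡ (*-cong (trans (*-congˡ (δ-refl q)) (*-identityʳ c)) (sym (B-q j))))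
             (λ i≢q j → sym (unchanged i≢q j)) (λ i≢q j → trans (B-≢ i≢q j) (sym (unchanged i≢q j))) ⟩
      det A + c * det B
        ≈⟨ +-congˡ (trans (*-congˡ (det-alternating B p≢q (λ j → trans (B-≢ p≢q j) (sym (B-q j))))) (zeroʳ c)) ⟩
      det A + 0#         ≈⟨ +-identityʳ _ ⟩
      det A              ∎
      where
      B : Matrix _ _
      B i = if does (q ≟ i) then A p else A i

      B-q : ∀ j → B q j ≈ A p j
      B-q j with q ≟ q
      ... | yes _   = refl
      ... | no  q≢q = contradiction ≡.refl q≢q

      B-≢ : ∀ {i} → i ≢ q → ∀ j → B i j ≈ A i j
      B-≢ {i} i≢q j with q ≟ i
      ... | yes q≡i = contradiction (≡.sym q≡i) i≢q
      ... | no  _   = refl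

      unchanged : ∀ {i} → i ≢ q → ∀ j → A i j + c * δ q i * A p j ≈ A i j
      unchanged {i} i≢q j = begin
        A i j + c * δ q i * A p j  ≈⟨ +-congˡ (*-congʳ (trans (*-congˡ (δ-≢ (i≢q ∘ ≡.sym))) (zeroʳ c))) ⟩
        A i j + 0# * A p j         ≈⟨ +-congˡ (zeroˡ _) ⟩
        A i j + 0#                 ≈⟨ +-identityʳ _ ⟩
        A i j                      ∎

    -- The rows ι a themselves do not change, so the operations can be carried
    -- out one value of a after another.
    iterate : ∀ {t n} (ι : Fin t → Fin n) (C : Fin t → Vector Carrier n) →
      (∀ a b → C a (ι b) ≈ 0#) → (∀ a A → det (λ i j → A i j + C a i * A (ι a) j) ≈ det A) →
      ∀ A → det (addRows ι C A) ≈ det A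
    iterate {zero}  ι C C≈0 one A = det-cong λ i j → +-identityʳ (A i j)
    iterate {suc t} ι C C≈0 one A = begin
      det (addRows ι C A)
        ≈⟨ det-cong (λ i j → begin
             A i j + (C zero i * A (ι zero) j + sum (λ a → C (suc a) i * A (ι (suc a)) j))
               ≈⟨ +-assoc _ _ _ ⟨
             A₁ i j + sum (λ a → C (suc a) i * A (ι (suc a)) j)
               ≈⟨ +-congˡ (sum-cong-≋ λ a → *-congˡ {x = C (suc a) i} (begin
                    A (ι (suc a)) j                                 ≈⟨ +-identityʳ _ ⟨
                    A (ι (suc a)) j + 0#
                      ≈⟨ +-congˡ (trans (*-congʳ (C≈0 zero (suc a))) (zeroˡ _)) ⟨
                    A₁ (ι (suc a)) j                                ∎)) ⟩
             A₁ i j + sum (λ a → C (suc a) i * A₁ (ι (suc a)) j)    ∎) ⟩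
      det (addRows (ι ∘ suc) (C ∘ suc) A₁)
        ≈⟨ iterate (ι ∘ suc) (C ∘ suc) (λ a b → C≈0 (suc a) (suc b)) (one ∘ suc) A₁ ⟩
      det A₁                                ≈⟨ one zero A ⟩
      det A                                 ∎
      where
      A₁ : Matrix _ _
      A₁ i j = A i j + C zero i * A (ι zero) j

  det-addRow : ∀ {n} (p : Fin n) (c : Vector Carrier n) → c p ≈ 0# → ∀ A →
    det (λ i j → A i j + c i * A p j) ≈ det A
  det-addRow {n} p c cp≈0 A = begin
    det (λ i j → A i j + c i * A p j)
      ≈⟨ det-cong (λ i j → +-congˡ (begin
           c i * A p j
             ≈⟨ *-congʳ (trans (sum-cong-≋ (λ q → trans (*-comm _ _) (*-congʳ (δ-sym q i)))) (sum-δ i c)) ⟨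
           sum (λ q → c q * δ q i) * A p j           ≈⟨ *-distribʳ-sum (A p j) (λ q → c q * δ q i) ⟩
           sum (λ q → c q * δ q i * A p j)           ∎)) ⟩
    det (addRows (λ _ → p) (λ q i → c q * δ q i) A)  ≈⟨ iterate (λ _ → p) (λ q i → c q * δ q i) at-p one A ⟩
    det A                                            ∎
    where
    at-p : ∀ q (b : Fin n) → c q * δ q p ≈ 0#
    at-p q _ with q ≟ p
    ... | yes ≡.refl = trans (*-congʳ cp≈0) (zeroˡ _)
    ... | no  _      = zeroʳ _

    one : ∀ q A → det (λ i j → A i j + c q * δ q i * A p j) ≈ det A
    one q A with p ≟ q
    ... | no  p≢q    = det-addRow₁ A (c q) p≢q
    ... | yes ≡.refl = det-cong λ i j → begin
      A i j + c p * δ p i * A p j  ≈⟨ +-congˡ (*-congʳ (trans (*-congʳ cp≈0) (zeroˡ _))) ⟩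
      A i j + 0# * A p j           ≈⟨ +-congˡ (zeroˡ _) ⟩
      A i j + 0#                   ≈⟨ +-identityʳ _ ⟩
      A i j                        ∎

  -- Several rows ι a, left alone themselves, are added to other rows at once.
  det-addRows : ∀ {t n} (ι : Fin t → Fin n) (C : Fin t → Vector Carrier n) → (∀ a b → C a (ι b) ≈ 0#) →
    ∀ A → det (λ i j → A i j + sum λ a → C a i * A (ι a) j) ≈ det A
  det-addRows ι C C≈0 = iterate ι C C≈0 (λ a → det-addRow (ι a) (C a) (C≈0 a a))

  det-scaleRows : ∀ {n} (c : Vector Carrier n) (A : Matrix n n) →
    det (λ i j → c i * A i j) ≈ product c * det A
  det-scaleRows {zero}  c A = sym (*-identityˡ 1#)
  det-scaleRows {suc n} c A = begin
    sum (λ j → sign j * (c zero * A zero j) * det (λ k l → c (suc k) * rowMinor A j k l))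
      ≈⟨ sum-cong-≋ (λ j → trans (*-congˡ (det-scaleRows (c ∘ suc) (rowMinor A j)))
           (pull (sign j) (c zero) (A zero j) (product (c ∘ suc)) (det (rowMinor A j)))) ⟩
    sum (λ j → product c * (sign j * A zero j * det (rowMinor A j)))
      ≈⟨ *-distribˡ-sum (product c) (λ j → sign j * A zero j * det (rowMinor A j)) ⟨
    product c * det A  ∎
    where
    pull : ∀ s c a p d → s * (c * a) * (p * d) ≈ c * p * (s * a * d)
    pull = solve 5 (λ s c a p d → s :* (c :* a) :* (p :* d) := c :* p :* (s :* a :* d)) refl

  det-firstColumn : ∀ {n} (A : Matrix (suc n) (suc n)) → (∀ i → A (suc i) zero ≈ 0#) →
    det A ≈ A zero zero * det (λ i j → A (suc i) (suc j))
  det-firstColumn A A≈0 = begin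
    det A  ≈⟨ det-column A ⟩
    1# * A zero zero * det (columnMinor A zero) + sum (λ i → sign (suc i) * A (suc i) zero * det (columnMinor A (suc i)))
      ≈⟨ +-cong (*-congʳ (*-identityˡ _)) (sum-zero λ i →
           trans (*-congʳ (trans (*-congˡ (A≈0 i)) (zeroʳ _))) (zeroˡ _)) ⟩
    A zero zero * det (columnMinor A zero) + 0#  ≈⟨ +-identityʳ _ ⟩
    A zero zero * det (columnMinor A zero)       ∎

  -- The first m columns are those of the identity matrix.
  det-blockUpper : ∀ m {n} (A : Matrix (m ℕ.+ n) (m ℕ.+ n)) →
    (∀ i a → A i (a Fin.↑ˡ n) ≈ δ i (a Fin.↑ˡ n)) →
    det A ≈ det (λ i j → A (m Fin.↑ʳ i) (m Fin.↑ʳ j))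
  det-blockUpper zero    A left = refl
  det-blockUpper (suc m) {n} A left = begin
    det A                                                  ≈⟨ det-firstColumn A (λ i → left (suc i) zero) ⟩
    A zero zero * det (λ i j → A (suc i) (suc j))          ≈⟨ *-congʳ (left zero zero) ⟩
    1# * det (λ i j → A (suc i) (suc j))                   ≈⟨ *-identityˡ _ ⟩
    det (λ i j → A (suc i) (suc j))
      ≈⟨ det-blockUpper m (λ i j → A (suc i) (suc j)) (λ i a → left (suc i) (suc a)) ⟩
    det (λ i j → A (suc (m Fin.↑ʳ i)) (suc (m Fin.↑ʳ j)))  ∎

-- The order

module Order {c ℓ₁ ℓ₂ : Level} (F : OrderedField c ℓ₁ ℓ₂) where

  open Base F
  open IsStrictPartialOrder <-isStrictPartialOrder public
    using (<-respˡ-≈; <-respʳ-≈) renaming (trans to <-trans; irrefl to <-irrefl)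

  <-resp : ∀ {x y u v} → x ≈ u → y ≈ v → x < y → u < v
  <-resp x≈u y≈v = <-respˡ-≈ x≈u ∘ <-respʳ-≈ y≈v

  ≤-respʳ-≈ : ∀ {x y z} → y ≈ z → x ≤ y → x ≤ z
  ≤-respʳ-≈ y≈z x≤y z<x = x≤y (<-respˡ-≈ (sym y≈z) z<x)

  <⇒≤ : ∀ {x y} → x < y → x ≤ y
  <⇒≤ x<y y<x = <-irrefl refl (<-trans x<y y<x)

  ¬#⇒≈ : ∀ {x y} → ¬ (x # y) → x ≈ y
  ¬#⇒≈ {x} {y} = proj₁ (tight x y)

  ≮≯⇒≈ : ∀ {x y} → ¬ (x < y) → ¬ (y < x) → x ≈ y
  ≮≯⇒≈ x≮y y≮x = ¬#⇒≈ λ x#y → case (#⇒<⊎> x#y)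
    where
    case : _ → _
    case (inj₁ x<y) = x≮y x<y
    case (inj₂ y<x) = y≮x y<x

  x<y⇒0<y-x : ∀ {x y} → x < y → 0# < y - x
  x<y⇒0<y-x {x} x<y = <-respˡ-≈ (-‿inverseʳ x) (+-monoˡ-< (- x) x<y)

  x<0⇒0<-x : ∀ {x} → x < 0# → 0# < - x
  x<0⇒0<-x x<0 = <-respʳ-≈ (+-identityˡ _) (x<y⇒0<y-x x<0)

  invertible⇒#0 : ∀ {x y} → x * y ≈ 1# → x # 0#
  invertible⇒#0 {x} {y} xy≈1 = invertible⇒# (y , trans (*-comm _ _) lemma , lemma)
    where
    lemma : (x - 0#) * y ≈ 1#
    lemma = trans (solve 2 (λ x y → (x :- con (+ 0)) :* y := x :* y) refl x y) xy≈1

  #0⇒inverse : ∀ {x} → x # 0# → ∃[ y ] x * y ≈ 1#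
  #0⇒inverse {x} x#0 with y , _ , xy≈1 ← #⇒invertible x#0 =
    y , trans (solve 2 (λ x y → x :* y := (x :- con (+ 0)) :* y) refl x y) xy≈1

  0<⇒#0 : ∀ {x} → 0# < x → x # 0#
  0<⇒#0 0<x = #-sym (<⇒# 0<x)

  #0-cancel : ∀ {x y} → x # 0# → x * y ≈ 0# → y ≈ 0#
  #0-cancel {x} {y} x#0 xy≈0 with z , xz≈1 ← #0⇒inverse x#0 = begin
    y            ≈⟨ *-identityˡ y ⟨
    1# * y       ≈⟨ *-congʳ xz≈1 ⟨
    x * z * y    ≈⟨ solve 3 (λ x y z → x :* z :* y := x :* y :* z) refl x y z ⟩
    x * y * z    ≈⟨ *-congʳ xy≈0 ⟩
    0# * z       ≈⟨ zeroˡ z ⟩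
    0#           ∎

  *-#0 : ∀ {x y} → x * y # 0# → x # 0#
  *-#0 {x} {y} xy#0 with z , xyz≈1 ← #0⇒inverse xy#0 =
    invertible⇒#0 (trans (sym (*-assoc x y z)) xyz≈1)

  0<x²  : ∀ {x} → x # 0# → 0# < x * x
  0<x² {x} x#0 with #⇒<⊎> x#0
  ... | inj₂ 0<x = *-pos 0<x 0<x
  ... | inj₁ x<0 = <-respʳ-≈ (solve 1 (λ x → :- x :* :- x := x :* x) refl x)
                     (*-pos (x<0⇒0<-x x<0) (x<0⇒0<-x x<0))

  0≤x² : ∀ x → 0# ≤ x * x
  0≤x² x xx<0 = <⇒≤ (0<x² (*-#0 (<⇒# xx<0))) xx<0

  0<inverse : ∀ {x y} → x * y ≈ 1# → 0# < x → 0# < y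
  0<inverse {x} {y} xy≈1 0<x with #⇒<⊎> (invertible⇒#0 (trans (*-comm y x) xy≈1))
  ... | inj₂ 0<y = 0<y
  ... | inj₁ y<0 = contradiction (<-trans 0<-1 -1<0) (<-irrefl refl)
    where
    0<-1 : 0# < - 1#
    0<-1 = <-respʳ-≈ (trans (sym (-‿distribʳ-* x y)) (-‿cong xy≈1)) (*-pos 0<x (x<0⇒0<-x y<0))

    -1<0 : - 1# < 0#
    -1<0 = <-resp (+-identityˡ _) (-‿inverseʳ 1#) (+-monoˡ-< (- 1#) 0<1)

  0<0≤⇒0<+ : ∀ {x y} → 0# < x → 0# ≤ y → 0# < x + y
  0<0≤⇒0<+ {x} {y} 0<x 0≤y with #-cotrans (0<⇒#0 0<x) (x + y)
  ... | inj₁ x#x+y with #⇒<⊎> x#x+y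
  ...   | inj₁ x<x+y = <-trans 0<x x<x+y
  ...   | inj₂ x+y<x = contradiction
            (<-resp (solve 2 (λ x y → x :+ y :- x := y) refl x y) (-‿inverseʳ x) (+-monoˡ-< (- x) x+y<x)) 0≤y
  0<0≤⇒0<+ {x} {y} 0<x 0≤y | inj₂ x+y#0 with #⇒<⊎> x+y#0
  ...   | inj₁ x+y<0 = contradiction (<-trans (<-respˡ-≈ (+-identityˡ y) (+-monoˡ-< y 0<x)) x+y<0) 0≤y
  ...   | inj₂ 0<x+y = 0<x+y

  0≤+ : ∀ {x y} → 0# ≤ x → 0# ≤ y → 0# ≤ x + y
  0≤+ {x} {y} 0≤x 0≤y x+y<0 with #-cotrans (<⇒# x+y<0) x
  ... | inj₂ x#0 with #⇒<⊎> x#0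
  ...   | inj₁ x<0 = 0≤x x<0
  ...   | inj₂ 0<x = <⇒≤ (0<0≤⇒0<+ 0<x 0≤y) x+y<0
  0≤+ {x} {y} 0≤x 0≤y x+y<0 | inj₁ x+y#x with #⇒<⊎> x+y#x
  ...   | inj₁ x+y<x = 0≤y (<-resp (solve 2 (λ x y → x :+ y :- x := y) refl x y) (-‿inverseʳ x) (+-monoˡ-< (- x) x+y<x))
  ...   | inj₂ x<x+y = <⇒≤ (0<0≤⇒0<+ 0<y 0≤x) (<-respˡ-≈ (+-comm x y) x+y<0)
    where
    0<y : 0# < y
    0<y = <-resp (-‿inverseʳ x) (solve 2 (λ x y → x :+ y :- x := y) refl x y) (+-monoˡ-< (- x) x<x+y)

  0≤* : ∀ {x y} → 0# ≤ x → 0# ≤ y → 0# ≤ x * y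
  0≤* {x} {y} 0≤x 0≤y xy<0 with #⇒<⊎> (*-#0 (<⇒# xy<0)) | #⇒<⊎> (*-#0 (<⇒# (<-respˡ-≈ (*-comm x y) xy<0)))
  ... | inj₁ x<0 | _        = 0≤x x<0
  ... | inj₂ _   | inj₁ y<0 = 0≤y y<0
  ... | inj₂ 0<x | inj₂ 0<y = <⇒≤ (*-pos 0<x 0<y) xy<0

  0≤0 : 0# ≤ 0#
  0≤0 = <-irrefl refl

  0≤sum : ∀ {n} {f : Vector Carrier n} → (∀ i → 0# ≤ f i) → 0# ≤ sum f
  0≤sum {zero}  0≤f = 0≤0
  0≤sum {suc n} 0≤f = 0≤+ (0≤f zero) (0≤sum (0≤f ∘ suc))

  0<product : ∀ {n} {f : Vector Carrier n} → (∀ i → 0# < f i) → 0# < product f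
  0<product {zero}  0<f = 0<1
  0<product {suc n} 0<f = *-pos (0<f zero) (0<product (0<f ∘ suc))

-- Determinants of diagonally dominant matrices

module Positivity {c ℓ₁ ℓ₂ : Level} (F : OrderedField c ℓ₁ ℓ₂) where

  open Base F
  open Order F
  open Determinants F

  -- A matrix with nonpositive entries off the diagonal and positive row sums
  -- has positive determinant: eliminating the first column leaves a matrix of
  -- the same kind.
  0<det : ∀ {n} (A : Matrix n n) → (∀ {i j} → i ≢ j → 0# ≤ - A i j) → (∀ i → 0# < sum (A i)) → 0# < det A
  0<det {zero}  A offDiagonal rowSum = 0<1
  0<det {suc n} A offDiagonal rowSum = <-respʳ-≈ (sym eliminated) (*-pos 0<a (0<det A′ offDiagonal′ rowSum′))
    where
    a : Carrier
    a = A zero zero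

    sum-neg : ∀ {n} (f : Vector Carrier n) → sum (λ i → - f i) ≈ - sum f
    sum-neg {zero}  f = sym -0#≈0#
    sum-neg {suc n} f = trans (+-congˡ (sum-neg (f ∘ suc))) (-‿+-comm _ _)

    0<a : 0# < a
    0<a = <-respʳ-≈ (begin
      a + s + sum (λ j → - A zero (suc j))  ≈⟨ +-congˡ (sum-neg (λ j → A zero (suc j))) ⟩
      a + s - s                             ≈⟨ solve 2 (λ a s → a :+ s :- s := a) refl a s ⟩
      a                                     ∎)
      (0<0≤⇒0<+ (rowSum zero) (0≤sum {f = λ j → - A zero (suc j)} λ j → offDiagonal {zero} {suc j} λ ()))
      where
      s : Carrier
      s = sum (λ j → A zero (suc j))

    a⁻¹ : Carrier
    a⁻¹ = proj₁ (#0⇒inverse (0<⇒#0 0<a))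

    aa⁻¹≈1 : a * a⁻¹ ≈ 1#
    aa⁻¹≈1 = proj₂ (#0⇒inverse (0<⇒#0 0<a))

    -- The multiple of the first row added to row i + 1.
    factor : Vector Carrier n
    factor i = - A (suc i) zero * a⁻¹

    0≤factor : ∀ i → 0# ≤ factor i
    0≤factor i = 0≤* (offDiagonal {suc i} {zero} λ ()) (<⇒≤ (0<inverse aa⁻¹≈1 0<a))

    factor-a : ∀ i → factor i * a ≈ - A (suc i) zero
    factor-a i = begin
      - A (suc i) zero * a⁻¹ * a
        ≈⟨ solve 3 (λ x y z → x :* y :* z := x :* (z :* y)) refl (- A (suc i) zero) a⁻¹ a ⟩
      - A (suc i) zero * (a * a⁻¹)  ≈⟨ *-congˡ aa⁻¹≈1 ⟩
      - A (suc i) zero * 1#         ≈⟨ *-identityʳ _ ⟩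
      - A (suc i) zero              ∎

    -- The Schur complement of the entry a.
    A′ : Matrix n n
    A′ i j = A (suc i) (suc j) + factor i * A zero (suc j)

    eliminated : det A ≈ a * det A′
    eliminated = begin
      det A  ≈⟨ det-addRow zero (0# ∷ factor) refl A ⟨
      det B  ≈⟨ det-firstColumn B (λ i → trans (+-congˡ (factor-a i)) (-‿inverseʳ _)) ⟩
      (a + 0# * a) * det A′  ≈⟨ *-congʳ (trans (+-congˡ (zeroˡ a)) (+-identityʳ a)) ⟩
      a * det A′             ∎
      where
      B : Matrix (suc n) (suc n)
      B i j = A i j + (0# ∷ factor) i * A zero j

    offDiagonal′ : ∀ {i j} → i ≢ j → 0# ≤ - A′ i j
    offDiagonal′ {i} {j} i≢j = ≤-respʳ-≈
      (solve 3 (λ x f y → :- x :+ f :* :- y := :- (x :+ f :* y)) refl (A (suc i) (suc j)) (factor i) (A zero (suc j)))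
      (0≤+ (offDiagonal λ { ≡.refl → i≢j ≡.refl }) (0≤* (0≤factor i) (offDiagonal λ ())))

    rowSum′ : ∀ i → 0# < sum (A′ i)
    rowSum′ i = <-respʳ-≈ (begin
      A (suc i) zero + sᵢ + factor i * (a + s₀)
        ≈⟨ solve 5 (λ x y f z w → x :+ y :+ f :* (z :+ w) := (x :+ f :* z) :+ (y :+ f :* w)) refl
             (A (suc i) zero) sᵢ (factor i) a s₀ ⟩
      (A (suc i) zero + factor i * a) + (sᵢ + factor i * s₀)
        ≈⟨ +-congʳ (trans (+-congˡ (factor-a i)) (-‿inverseʳ _)) ⟩
      0# + (sᵢ + factor i * s₀)  ≈⟨ +-identityˡ _ ⟩
      sᵢ + factor i * s₀         ≈⟨ +-congˡ (*-distribˡ-sum (factor i) (λ j → A zero (suc j))) ⟩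
      sᵢ + sum (λ j → factor i * A zero (suc j))
        ≈⟨ ∑-distrib-+ (λ j → A (suc i) (suc j)) (λ j → factor i * A zero (suc j)) ⟨
      sum (A′ i)  ∎)
      (0<0≤⇒0<+ (rowSum (suc i)) (0≤* (0≤factor i) (<⇒≤ (rowSum zero))))
      where
      s₀ sᵢ : Carrier
      s₀ = sum (λ j → A zero (suc j))
      sᵢ = sum (λ j → A (suc i) (suc j))

-- Polynomial functions

module Polynomials {c ℓ₁ ℓ₂ : Level} (F : OrderedField c ℓ₁ ℓ₂) where

  open Base F
  open Order F

  -- Poly d f: f is a polynomial function of degree less than d.  This is
  -- expressed without coefficients, by the divisibility of f x - f p by x - p
  -- for every p, with a quotient of degree less than d - 1.
  data Poly : ℕ → (Carrier → Carrier) → Set (c ⊔ ℓ₁) where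
    vanishing : ∀ {f} → (∀ x → f x ≈ 0#) → Poly zero f
    divisible : ∀ {d f} → (∀ p → ∃[ q ] Poly d q ∧ (∀ x → f x ≈ f p + (x - p) * q x)) → Poly (suc d) f

  poly-zero : ∀ d {f} → (∀ x → f x ≈ 0#) → Poly d f
  poly-zero zero        f≈0 = vanishing f≈0
  poly-zero (suc d) {f} f≈0 = divisible λ p → (λ _ → 0#) , poly-zero d (λ _ → refl) , λ x → begin
    f x                ≈⟨ f≈0 x ⟩
    0#                 ≈⟨ solve 1 (λ y → con (+ 0) := con (+ 0) :+ y :* con (+ 0)) refl (x - p) ⟩
    0# + (x - p) * 0#  ≈⟨ +-congʳ (f≈0 p) ⟨
    f p + (x - p) * 0# ∎

  poly-cong : ∀ {d f g} → (∀ x → f x ≈ g x) → Poly d f → Poly d g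
  poly-cong f≈g (vanishing f≈0) = vanishing λ x → trans (sym (f≈g x)) (f≈0 x)
  poly-cong {f = f} {g} f≈g (divisible div) = divisible λ p → let q , q-poly , f≈ = div p in
    q , q-poly , λ x → trans (sym (f≈g x)) (trans (f≈ x) (+-congʳ (f≈g p)))

  poly-mono : ∀ {d f} → Poly d f → Poly (suc d) f
  poly-mono {zero}  (vanishing f≈0) = poly-zero 1 f≈0
  poly-mono {suc d} (divisible div) = divisible λ p → let q , q-poly , f≈ = div p in
    q , poly-mono q-poly , f≈

  poly-1 : Poly 1 (λ _ → 1#)
  poly-1 = divisible λ p → (λ _ → 0#) , vanishing (λ _ → refl) ,
    λ x → sym (trans (+-congˡ (zeroʳ _)) (+-identityʳ 1#))

  poly-+ : ∀ {d f g} → Poly d f → Poly d g → Poly d (λ x → f x + g x)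
  poly-+ {zero} (vanishing f≈0) (vanishing g≈0) =
    vanishing λ x → trans (+-cong (f≈0 x) (g≈0 x)) (+-identityʳ 0#)
  poly-+ {suc d} {f} {g} (divisible f-div) (divisible g-div) = divisible λ p →
    let q , q-poly , f≈ = f-div p
        r , r-poly , g≈ = g-div p
    in (λ x → q x + r x) , poly-+ q-poly r-poly , λ x → trans (+-cong (f≈ x) (g≈ x))
      (solve 5 (λ f q g r y → f :+ y :* q :+ (g :+ y :* r) := f :+ g :+ y :* (q :+ r)) refl
        (f p) (q x) (g p) (r x) (x - p))

  poly-scale : ∀ {d f} a → Poly d f → Poly d (λ x → a * f x)
  poly-scale {zero} a (vanishing f≈0) = vanishing λ x → trans (*-congˡ (f≈0 x)) (zeroʳ a)
  poly-scale {suc d} {f} a (divisible div) = divisible λ p → let q , q-poly , f≈ = div p in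
    (λ x → a * q x) , poly-scale a q-poly , λ x → trans (*-congˡ (f≈ x))
      (solve 4 (λ a f y q → a :* (f :+ y :* q) := a :* f :+ y :* (a :* q)) refl a (f p) (x - p) (q x))

  poly-affine : ∀ {d f} a b → Poly d f → Poly (suc d) (λ x → (a * x + b) * f x)
  poly-affine a b (vanishing f≈0) = poly-zero 1 λ x → trans (*-congˡ (f≈0 x)) (zeroʳ _)
  poly-affine {suc d} {f} a b fp@(divisible div) = divisible λ p → let q , q-poly , f≈ = div p in
    (λ x → a * f x + (a * p + b) * q x) ,
    poly-+ (poly-scale a fp) (poly-scale (a * p + b) (poly-mono q-poly)) ,
    λ x → begin
      (a * x + b) * f x
        ≈⟨ solve 5 (λ a b x p f → (a :* x :+ b) :* f := (a :* p :+ b) :* f :+ (x :- p) :* (a :* f)) refl a b x p (f x) ⟩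
      (a * p + b) * f x + (x - p) * (a * f x)
        ≈⟨ +-congʳ (*-congˡ (f≈ x)) ⟩
      (a * p + b) * (f p + (x - p) * q x) + (x - p) * (a * f x)
        ≈⟨ solve 5 (λ e fp y q g → e :* (fp :+ y :* q) :+ y :* g := e :* fp :+ y :* (g :+ e :* q)) refl
             (a * p + b) (f p) (x - p) (q x) (a * f x) ⟩
      (a * p + b) * f p + (x - p) * (a * f x + (a * p + b) * q x) ∎

  poly-sum : ∀ {d n} {f : Fin n → Carrier → Carrier} → (∀ i → Poly d (f i)) → Poly d (λ x → sum λ i → f i x)
  poly-sum {d} {zero}  fp = poly-zero d (λ _ → refl)
  poly-sum {d} {suc n} fp = poly-+ (fp zero) (poly-sum (fp ∘ suc))

  poly-det : ∀ {n} (A B : Matrix n n) → Poly (suc n) (λ x → det λ i j → A i j * x + B i j)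
  poly-det {zero}  A B = poly-1
  poly-det {suc n} A B = poly-sum λ j →
    poly-cong (λ x → sym (*-assoc _ _ _)) (poly-scale ((- 1#) ^ toℕ j) (poly-affine (A zero j) (B zero j)
      (poly-det (λ i k → A (suc i) (punchIn j k)) (λ i k → B (suc i) (punchIn j k)))))

  poly-product : ∀ {n} (r : Vector Carrier n) → Poly (suc n) (λ x → product λ i → x - r i)
  poly-product {zero}  r = poly-1
  poly-product {suc n} r = poly-cong (λ x → *-congʳ (+-congʳ (*-identityˡ x)))
    (poly-affine 1# (- r zero) (poly-product (r ∘ suc)))

  -- A polynomial function that vanishes above a vanishes everywhere: taking
  -- the root a + 1 as p, the quotient vanishes above a + 1.
  poly-vanish : ∀ {d f} → Poly d f → ∀ a → (∀ x → a < x → f x ≈ 0#) → ∀ x → f x ≈ 0#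
  poly-vanish {zero} (vanishing f≈0) a _ = f≈0
  poly-vanish {suc d} {f} (divisible div) a above with q , q-poly , f≈ ← div (a + 1#) = λ x → begin
    f x                  ≈⟨ f≈ x ⟩
    f p + (x - p) * q x  ≈⟨ +-cong (above p a<p) (*-congˡ (poly-vanish q-poly p q-above x)) ⟩
    0# + (x - p) * 0#    ≈⟨ solve 1 (λ y → con (+ 0) :+ y :* con (+ 0) := con (+ 0)) refl (x - p) ⟩
    0#                   ∎
    where
    p : Carrier
    p = a + 1#

    a<p : a < p
    a<p = <-resp (+-identityˡ a) (+-comm 1# a) (+-monoˡ-< a 0<1)

    q-above : ∀ x → p < x → q x ≈ 0#
    q-above x p<x = #0-cancel (0<⇒#0 (x<y⇒0<y-x p<x)) (begin
      (x - p) * q x        ≈⟨ +-identityˡ _ ⟨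
      0# + (x - p) * q x   ≈⟨ +-congʳ (above p a<p) ⟨
      f p + (x - p) * q x  ≈⟨ f≈ x ⟨
      f x                  ≈⟨ above x (<-trans a<p p<x) ⟩
      0#                   ∎)

-- Moore-Penrose inverses

module MoorePenrose {c ℓ₁ ℓ₂ : Level} (F : OrderedField c ℓ₁ ℓ₂) where

  open Base F

  ≋-sym : ∀ {m n} {A B : Matrix m n} → A ≋ B → B ≋ A
  ≋-sym A≋B i j = sym (A≋B i j)

  ⊗-congˡ : ∀ {l m n} (A : Matrix l m) {B B′ : Matrix m n} → B ≋ B′ → A ⊗ B ≋ A ⊗ B′
  ⊗-congˡ A B≋B′ i j = sum-cong-≋ λ k → *-congˡ (B≋B′ k j)

  ⊗-congʳ : ∀ {l m n} {A A′ : Matrix l m} (B : Matrix m n) → A ≋ A′ → A ⊗ B ≋ A′ ⊗ B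
  ⊗-congʳ B A≋A′ i j = sum-cong-≋ λ k → *-congʳ (A≋A′ i k)

  ⊗-assoc : ∀ {k l m n} (A : Matrix k l) (B : Matrix l m) (C : Matrix m n) → A ⊗ B ⊗ C ≋ A ⊗ (B ⊗ C)
  ⊗-assoc A B C i j = begin
    sum (λ b → sum (λ a → A i a * B a b) * C b j)
      ≈⟨ sum-cong-≋ (λ b → *-distribʳ-sum (C b j) (λ a → A i a * B a b)) ⟩
    sum (λ b → sum (λ a → A i a * B a b * C b j))
      ≈⟨ ∑-comm (λ b a → A i a * B a b * C b j) ⟩
    sum (λ a → sum (λ b → A i a * B a b * C b j))
      ≈⟨ sum-cong-≋ (λ a → sum-cong-≋ (λ b → *-assoc (A i a) (B a b) (C b j))) ⟩
    sum (λ a → sum (λ b → A i a * (B a b * C b j)))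
      ≈⟨ sum-cong-≋ (λ a → *-distribˡ-sum (A i a) (λ b → B a b * C b j)) ⟨
    sum (λ a → A i a * (B ⊗ C) a j)  ∎

  transpose-⊗ : ∀ {l m n} (A : Matrix l m) (B : Matrix m n) → transpose (A ⊗ B) ≋ transpose B ⊗ transpose A
  transpose-⊗ A B i j = sum-cong-≋ λ k → *-comm (A j k) (B k i)

  module _ {m n : ℕ} {A : Matrix m n} where

    private
      -- A symmetric matrix.
      Symmetric : ∀ {k} → Matrix k k → Set _
      Symmetric P = transpose P ≋ P

      -- For orthogonal projections P and Q, the hypotheses say that the images
      -- are equal in the first lemma, and the kernels in the second.
      sameImage : ∀ {k} (P Q : Matrix k k) → Symmetric P → Symmetric Q → P ⊗ Q ≋ Q → Q ⊗ P ≋ P → P ≋ Q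
      sameImage P Q Pᵀ≋P Qᵀ≋Q PQ≋Q QP≋P i j = begin
        P i j                          ≈⟨ Pᵀ≋P j i ⟩
        P j i                          ≈⟨ QP≋P j i ⟨
        (Q ⊗ P) j i                    ≈⟨ transpose-⊗ Q P i j ⟩
        (transpose P ⊗ transpose Q) i j  ≈⟨ ⊗-congʳ (transpose Q) Pᵀ≋P i j ⟩
        (P ⊗ transpose Q) i j          ≈⟨ ⊗-congˡ P Qᵀ≋Q i j ⟩
        (P ⊗ Q) i j                    ≈⟨ PQ≋Q i j ⟩
        Q i j                          ∎

      sameKernel : ∀ {k} (P Q : Matrix k k) → Symmetric P → Symmetric Q → P ⊗ Q ≋ P → Q ⊗ P ≋ Q → P ≋ Q
      sameKernel P Q Pᵀ≋P Qᵀ≋Q PQ≋P QP≋Q i j = begin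
        P i j                          ≈⟨ Pᵀ≋P j i ⟩
        P j i                          ≈⟨ PQ≋P j i ⟨
        (P ⊗ Q) j i                    ≈⟨ transpose-⊗ P Q i j ⟩
        (transpose Q ⊗ transpose P) i j  ≈⟨ ⊗-congʳ (transpose P) Qᵀ≋Q i j ⟩
        (Q ⊗ transpose P) i j          ≈⟨ ⊗-congˡ Q Pᵀ≋P i j ⟩
        (Q ⊗ P) i j                    ≈⟨ QP≋Q i j ⟩
        Q i j                          ∎

      module _ {X Y : Matrix n m} (mpX : IsMoorePenrose A X) (mpY : IsMoorePenrose A Y) where

        private
          module X = IsMoorePenrose mpX
          module Y = IsMoorePenrose mpY

        AXAY≋AY : (A ⊗ X) ⊗ (A ⊗ Y) ≋ A ⊗ Y
        AXAY≋AY i j = begin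
          ((A ⊗ X) ⊗ (A ⊗ Y)) i j  ≈⟨ ⊗-assoc (A ⊗ X) A Y i j ⟨
          (A ⊗ X ⊗ A ⊗ Y) i j      ≈⟨ ⊗-congʳ Y X.AA†A≋A i j ⟩
          (A ⊗ Y) i j              ∎

        XAYA≋XA : (X ⊗ A) ⊗ (Y ⊗ A) ≋ X ⊗ A
        XAYA≋XA i j = begin
          ((X ⊗ A) ⊗ (Y ⊗ A)) i j  ≈⟨ ⊗-assoc X A (Y ⊗ A) i j ⟩
          (X ⊗ (A ⊗ (Y ⊗ A))) i j  ≈⟨ ⊗-congˡ X (≋-sym (⊗-assoc A Y A)) i j ⟩
          (X ⊗ (A ⊗ Y ⊗ A)) i j    ≈⟨ ⊗-congˡ X Y.AA†A≋A i j ⟩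
          (X ⊗ A) i j              ∎

    moorePenrose-unique : ∀ {X Y : Matrix n m} → IsMoorePenrose A X → IsMoorePenrose A Y → X ≋ Y
    moorePenrose-unique {X} {Y} mpX mpY i j = begin
      X i j                ≈⟨ X.A†AA†≋A† i j ⟨
      (X ⊗ A ⊗ X) i j      ≈⟨ ⊗-assoc X A X i j ⟩
      (X ⊗ (A ⊗ X)) i j    ≈⟨ ⊗-congˡ X AX≋AY i j ⟩
      (X ⊗ (A ⊗ Y)) i j    ≈⟨ ⊗-assoc X A Y i j ⟨
      (X ⊗ A ⊗ Y) i j      ≈⟨ ⊗-congʳ Y XA≋YA i j ⟩
      (Y ⊗ A ⊗ Y) i j      ≈⟨ Y.A†AA†≋A† i j ⟩
      Y i j                ∎
      where
      module X = IsMoorePenrose mpX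
      module Y = IsMoorePenrose mpY

      AX≋AY : A ⊗ X ≋ A ⊗ Y
      AX≋AY = sameImage (A ⊗ X) (A ⊗ Y) X.AA†-symm Y.AA†-symm (AXAY≋AY mpX mpY) (AXAY≋AY mpY mpX)

      XA≋YA : X ⊗ A ≋ Y ⊗ A
      XA≋YA = sameKernel (X ⊗ A) (Y ⊗ A) X.A†A-symm Y.A†A-symm (XAYA≋XA mpX mpY) (XAYA≋XA mpY mpX)

  moorePenrose-transpose : ∀ {m n} {A : Matrix m n} {X : Matrix n m} →
    IsMoorePenrose A X → IsMoorePenrose (transpose A) (transpose X)
  moorePenrose-transpose {A = A} {X} mp = record
    { AA†A≋A   = λ i j → trans (triple A X i j) (AA†A≋A j i)
    ; A†AA†≋A† = λ i j → trans (triple X A i j) (A†AA†≋A† j i)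
    ; AA†-symm = λ i j → trans (sym (transpose-⊗ X A j i)) (trans (A†A-symm j i) (transpose-⊗ X A i j))
    ; A†A-symm = λ i j → trans (sym (transpose-⊗ A X j i)) (trans (AA†-symm j i) (transpose-⊗ A X i j))
    }
    where
    open IsMoorePenrose mp

    triple : ∀ {m n} (B : Matrix m n) (C : Matrix n m) →
      transpose B ⊗ transpose C ⊗ transpose B ≋ transpose (B ⊗ C ⊗ B)
    triple B C i j = begin
      (transpose B ⊗ transpose C ⊗ transpose B) i j  ≈⟨ ⊗-congʳ (transpose B) (≋-sym (transpose-⊗ C B)) i j ⟩
      (transpose (C ⊗ B) ⊗ transpose B) i j          ≈⟨ transpose-⊗ B (C ⊗ B) i j ⟨
      (B ⊗ (C ⊗ B)) j i                              ≈⟨ ⊗-assoc B C B j i ⟨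
      (B ⊗ C ⊗ B) j i                                ∎

  moorePenrose-congˡ : ∀ {m n} {A A′ : Matrix m n} {X : Matrix n m} →
    A ≋ A′ → IsMoorePenrose A X → IsMoorePenrose A′ X
  moorePenrose-congˡ {A = A} {A′} {X} A≋A′ mp = record
    { AA†A≋A   = λ i j → begin
        (A′ ⊗ X ⊗ A′) i j  ≈⟨ ⊗-congˡ (A′ ⊗ X) A≋A′ i j ⟨
        (A′ ⊗ X ⊗ A) i j   ≈⟨ ⊗-congʳ A AX i j ⟨
        (A ⊗ X ⊗ A) i j    ≈⟨ AA†A≋A i j ⟩
        A i j              ≈⟨ A≋A′ i j ⟩
        A′ i j             ∎
    ; A†AA†≋A† = λ i j → trans (sym (⊗-congʳ X XA i j)) (A†AA†≋A† i j)
    ; AA†-symm = λ i j → trans (sym (AX j i)) (trans (AA†-symm i j) (AX i j))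
    ; A†A-symm = λ i j → trans (sym (XA j i)) (trans (A†A-symm i j) (XA i j))
    }
    where
    open IsMoorePenrose mp

    AX : A ⊗ X ≋ A′ ⊗ X
    AX = ⊗-congʳ X A≋A′

    XA : X ⊗ A ≋ X ⊗ A′
    XA = ⊗-congˡ X A≋A′

-- Laplacians and resistances

module Resistance {c ℓ₁ ℓ₂ : Level} (F : OrderedField c ℓ₁ ℓ₂) {n : ℕ} (G : Graph n) where

  open Base F
  open Order F
  open MoorePenrose F
  open Graph G using (adj; degree)

  private
    L : Matrix n n
    L = laplacian G

    a : Matrix n n
    a = adjacency G

    a-sym : ∀ i j → a i j ≈ a j i
    a-sym i j = reflexive (≡.cong (if_then 1# else 0#) (Graph.sym G i j))

    0≤a : ∀ i j → 0# ≤ a i j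
    0≤a i j with adj i j
    ... | true  = <⇒≤ 0<1
    ... | false = 0≤0

  laplacian-sym : transpose L ≋ L
  laplacian-sym i j = +-cong (diagonal-sym i j) (-‿cong (a-sym j i))
    where
    diagonal-sym : ∀ i j → diagonal (fromℕ ∘ degree) j i ≈ diagonal (fromℕ ∘ degree) i j
    diagonal-sym i j with i ≟ j
    ... | yes ≡.refl = trans (diagonal≈ (fromℕ ∘ degree) i i) (trans (*-congʳ (δ-refl i)) (*-identityˡ _))
    ... | no  i≢j    = trans (diagonal≈ (fromℕ ∘ degree) j i) (trans (*-congʳ (δ-≢ (i≢j ∘ ≡.sym))) (zeroˡ _))

  degree≈sum : ∀ i → fromℕ (degree i) ≈ sum (a i)
  degree≈sum i = count (adj i)
    where
    count : ∀ {n} (f : Fin n → Bool) → fromℕ ∣ tabulate f ∣ ≈ sum (λ j → if f j then 1# else 0#)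
    count {zero}  f = refl
    count {suc n} f with f zero
    ... | true  = +-congˡ (count (f ∘ suc))
    ... | false = trans (count (f ∘ suc)) (sym (+-identityˡ _))

  laplacian-apply : ∀ (w : Vector Carrier n) i → sum (λ j → L i j * w j) ≈ sum (λ j → a i j * (w i - w j))
  laplacian-apply w i = begin
    sum (λ j → L i j * w j)
      ≈⟨ sum-cong-≋ (λ j → begin
           (diagonal (fromℕ ∘ degree) i j - a i j) * w j
             ≈⟨ *-congʳ (+-congʳ (diagonal≈ (fromℕ ∘ degree) i j)) ⟩
           (δ i j * fromℕ (degree i) - a i j) * w j
             ≈⟨ solve 4 (λ d f a w → (d :* f :- a) :* w := d :* (f :* w) :- a :* w) refl
                  (δ i j) (fromℕ (degree i)) (a i j) (w j) ⟩
           δ i j * (fromℕ (degree i) * w j) - a i j * w j  ∎) ⟩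
    sum (λ j → δ i j * (fromℕ (degree i) * w j) - a i j * w j)
      ≈⟨ sum-distrib-- (λ j → δ i j * (fromℕ (degree i) * w j)) (λ j → a i j * w j) ⟩
    sum (λ j → δ i j * (fromℕ (degree i) * w j)) - sum (λ j → a i j * w j)
      ≈⟨ +-congʳ (sum-δ i (λ j → fromℕ (degree i) * w j)) ⟩
    fromℕ (degree i) * w i - sum (λ j → a i j * w j)
      ≈⟨ +-congʳ (trans (*-congʳ (degree≈sum i)) (*-distribʳ-sum (w i) (a i))) ⟩
    sum (λ j → a i j * w i) - sum (λ j → a i j * w j)
      ≈⟨ sum-distrib-- (λ j → a i j * w i) (λ j → a i j * w j) ⟨
    sum (λ j → a i j * w i - a i j * w j)
      ≈⟨ sum-cong-≋ (λ j → solve 3 (λ a u w → a :* u :- a :* w := a :* (u :- w)) refl (a i j) (w i) (w j)) ⟩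
    sum (λ j → a i j * (w i - w j))  ∎

  private
    -- The bilinear form of the Laplacian.
    B : Vector Carrier n → Vector Carrier n → Carrier
    B u v = sum λ i → u i * sum λ j → L i j * v j

  -- The Laplacian is positive semidefinite: B w w + B w w is the sum over all
  -- i and j of a i j * (w i - w j)².
  laplacian-psd : ∀ w → 0# ≤ B w w
  laplacian-psd w Bww<0 = 0≤2B (<-trans (<-respʳ-≈ (+-identityˡ _) (+-monoˡ-< (B w w) Bww<0)) Bww<0)
    where
    e : Fin n → Fin n → Carrier
    e i j = w i * (a i j * (w i - w j))

    B≈ : B w w ≈ sum (λ i → sum (λ j → e i j))
    B≈ = sum-cong-≋ λ i → trans (*-congˡ (laplacian-apply w i)) (*-distribˡ-sum (w i) (λ j → a i j * (w i - w j)))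

    2B≈ : B w w + B w w ≈ sum (λ i → sum (λ j → a i j * ((w i - w j) * (w i - w j))))
    2B≈ = begin
      B w w + B w w  ≈⟨ +-cong B≈ (trans B≈ (∑-comm e)) ⟩
      sum (λ i → sum (λ j → e i j)) + sum (λ i → sum (λ j → e j i))
        ≈⟨ ∑-distrib-+ (λ i → sum (λ j → e i j)) (λ i → sum (λ j → e j i)) ⟨
      sum (λ i → sum (λ j → e i j) + sum (λ j → e j i))
        ≈⟨ sum-cong-≋ (λ i → ∑-distrib-+ (λ j → e i j) (λ j → e j i)) ⟨
      sum (λ i → sum (λ j → e i j + e j i))
        ≈⟨ sum-cong-≋ (λ i → sum-cong-≋ (λ j → trans (+-congˡ (*-congˡ (*-congʳ (a-sym j i))))
             (solve 3 (λ a u w → u :* (a :* (u :- w)) :+ w :* (a :* (w :- u)) := a :* ((u :- w) :* (u :- w))) refl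
               (a i j) (w i) (w j)))) ⟩
      sum (λ i → sum (λ j → a i j * ((w i - w j) * (w i - w j))))  ∎

    0≤2B : 0# ≤ B w w + B w w
    0≤2B = ≤-respʳ-≈ (sym 2B≈) (0≤sum λ i → 0≤sum λ j → 0≤* (0≤a i j) (0≤x² (w i - w j)))

  module _ {X : Matrix n n} (mp : IsMoorePenrose L X) where

    L†-sym : transpose X ≋ X
    L†-sym = moorePenrose-unique (moorePenrose-congˡ laplacian-sym (moorePenrose-transpose mp)) mp

    private
      -- Column i of the Moore-Penrose inverse.
      column : Fin n → Vector Carrier n
      column i b = X b i

      B-column : ∀ i j → B (column i) (column j) ≈ X i j
      B-column i j = begin
        B (column i) (column j)  ≈⟨ ⊗-congʳ (L ⊗ X) L†-sym i j ⟩
        (X ⊗ (L ⊗ X)) i j        ≈⟨ ⊗-assoc X L X i j ⟨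
        (X ⊗ L ⊗ X) i j          ≈⟨ IsMoorePenrose.A†AA†≋A† mp i j ⟩
        X i j                    ∎

      B-distribʳ : ∀ u v w → B u (λ i → v i - w i) ≈ B u v - B u w
      B-distribʳ u v w = trans (sum-cong-≋ λ i → begin
        u i * sum (λ j → L i j * (v j - w j))
          ≈⟨ *-congˡ (sum-cong-≋ λ j → solve 3 (λ l v w → l :* (v :- w) := l :* v :- l :* w) refl (L i j) (v j) (w j)) ⟩
        u i * sum (λ j → L i j * v j - L i j * w j)
          ≈⟨ *-congˡ (sum-distrib-- (λ j → L i j * v j) (λ j → L i j * w j)) ⟩
        u i * (sum (λ j → L i j * v j) - sum (λ j → L i j * w j))
          ≈⟨ solve 3 (λ u v w → u :* (v :- w) := u :* v :- u :* w) refl (u i) (sum (λ j → L i j * v j)) (sum (λ j → L i j * w j)) ⟩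
        u i * sum (λ j → L i j * v j) - u i * sum (λ j → L i j * w j)  ∎)
        (sum-distrib-- (λ i → u i * sum (λ j → L i j * v j)) (λ i → u i * sum (λ j → L i j * w j)))

      B-distribˡ : ∀ u v w → B (λ i → u i - v i) w ≈ B u w - B v w
      B-distribˡ u v w = trans
        (sum-cong-≋ λ i → solve 3 (λ u v w → (u :- v) :* w := u :* w :- v :* w) refl (u i) (v i) (sum (λ j → L i j * w j)))
        (sum-distrib-- (λ i → u i * sum (λ j → L i j * w j)) (λ i → v i * sum (λ j → L i j * w j)))

    -- The expression is the quadratic form of X at e i - e j, which is that of
    -- L at column i - column j because X = X L X and X is symmetric.
    0≤resistance : ∀ i j → 0# ≤ X i i + X j j - fromℕ 2 * X i j
    0≤resistance i j = ≤-respʳ-≈ (begin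
      B (λ b → column i b - column j b) (λ b → column i b - column j b)
        ≈⟨ B-distribˡ (column i) (column j) _ ⟩
      B (column i) (λ b → column i b - column j b) - B (column j) (λ b → column i b - column j b)
        ≈⟨ +-cong (B-distribʳ (column i) (column i) (column j)) (-‿cong (B-distribʳ (column j) (column i) (column j))) ⟩
      B (column i) (column i) - B (column i) (column j) - (B (column j) (column i) - B (column j) (column j))
        ≈⟨ +-cong (+-cong (B-column i i) (-‿cong (B-column i j)))
             (-‿cong (+-cong (trans (B-column j i) (L†-sym i j)) (-‿cong (B-column j j)))) ⟩
      X i i - X i j - (X i j - X j j)
        ≈⟨ solve 3 (λ a b d → a :- b :- (b :- d) := a :+ d :- con (+ 2) :* b) refl (X i i) (X i j) (X j j) ⟩
      X i i + X j j - fromℕ 2 * X i j  ∎)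
      (laplacian-psd (λ b → column i b - column j b))

  module _ {R : Matrix n n} (res : IsResistanceMatrix G R) where

    open IsResistanceMatrix res

    resistance-nonneg : ∀ i j → 0# ≤ R i j
    resistance-nonneg i j = ≤-respʳ-≈ (sym (resistance i j)) (0≤resistance isMoorePenrose i j)

    resistance-sym : ∀ i j → R i j ≈ R j i
    resistance-sym i j = begin
      R i j                                ≈⟨ resistance i j ⟩
      L† i i + L† j j - fromℕ 2 * L† i j
        ≈⟨ +-cong (+-comm _ _) (-‿cong (*-congˡ (L†-sym isMoorePenrose j i))) ⟩
      L† j j + L† i i - fromℕ 2 * L† j i   ≈⟨ resistance j i ⟨
      R j i                                ∎

-- Matrices made of two copies

elim-+ : ∀ {p} m {n} (P : Fin (m ℕ.+ n) → Set p) → (∀ i → P (i ↑ˡ n)) → (∀ j → P (m ↑ʳ j)) → ∀ k → P k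
elim-+ zero    P left right k       = right k
elim-+ (suc m) P left right zero    = left zero
elim-+ (suc m) P left right (suc k) = elim-+ m (P ∘ suc) (left ∘ suc) right k

↑ˡ≢↑ʳ : ∀ {m n} (i : Fin m) (j : Fin n) → i ↑ˡ n ≢ m ↑ʳ j
↑ˡ≢↑ʳ {suc m} (suc i) j eq
  with () ← ≡.trans (≡.sym (splitAt-↑ˡ (suc m) (suc i) _))
              (≡.trans (≡.cong (splitAt (suc m)) eq) (splitAt-↑ʳ (suc m) _ j))

module SumSplit {c ℓ : Level} (M : CommutativeMonoid c ℓ) where

  open CommutativeMonoid M
  open import Algebra.Definitions.RawMonoid rawMonoid using (sum)

  sum-split : ∀ m {n} (f : Vector Carrier (m ℕ.+ n)) → sum f ≈ sum (f ∘ (_↑ˡ n)) ∙ sum (f ∘ (m ↑ʳ_))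
  sum-split zero    f = sym (identityˡ _)
  sum-split (suc m) f = trans (∙-congˡ (sum-split m (f ∘ suc))) (sym (assoc _ _ _))

-- Scalar multiples of matrices

module Scalars {c ℓ₁ ℓ₂ : Level} (F : OrderedField c ℓ₁ ℓ₂) where

  open Base F

  δ-injective : ∀ {m n} (f : Fin m → Fin n) → (∀ i j → f i ≡ f j → i ≡ j) → ∀ i j → δ (f i) (f j) ≈ δ i j
  δ-injective f f-inj i j with i ≟ j
  ... | yes ≡.refl = δ-refl (f i)
  ... | no  i≢j    = δ-≢ (i≢j ∘ f-inj i j)

  -- Scalar multiplication.
  infixr 8 _·_
  _·_ : ∀ {m n} → Carrier → Matrix m n → Matrix m n
  (a · A) i j = a * A i j

  ·-⊗ : ∀ {l m n} a (A : Matrix l m) (B : Matrix m n) → (a · A) ⊗ B ≋ a · (A ⊗ B)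
  ·-⊗ a A B i j = trans (sum-cong-≋ λ k → *-assoc a (A i k) (B k j)) (sym (*-distribˡ-sum a (λ k → A i k * B k j)))

  ⊗-· : ∀ {l m n} a (A : Matrix l m) (B : Matrix m n) → A ⊗ (a · B) ≋ a · (A ⊗ B)
  ⊗-· a A B i j = trans
    (sum-cong-≋ λ k → solve 3 (λ a x y → x :* (a :* y) := a :* (x :* y)) refl a (A i k) (B k j))
    (sym (*-distribˡ-sum a (λ k → A i k * B k j)))

-- Block matrices symmetric under the exchange of the copies

module Twins {c ℓ₁ ℓ₂ : Level} (F : OrderedField c ℓ₁ ℓ₂) (n : ℕ) where

  open Base F
  open MoorePenrose F
  open Scalars F
  open SumSplit +-commutativeMonoid

  -- The index of which the given one, in either copy of Fin n, is the copy.
  base : Fin (n ℕ.+ n) → Fin n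
  base p = [ id , id ]′ (splitAt n p)

  -- 1 on the first copy and -1 on the second.
  σ : Fin (n ℕ.+ n) → Carrier
  σ p = [ const 1# , const (- 1#) ]′ (splitAt n p)

  base-↑ˡ : ∀ i → base (i ↑ˡ n) ≡ i
  base-↑ˡ i = ≡.cong [ id , id ]′ (splitAt-↑ˡ n i n)

  base-↑ʳ : ∀ i → base (n ↑ʳ i) ≡ i
  base-↑ʳ i = ≡.cong [ id , id ]′ (splitAt-↑ʳ n n i)

  σ-↑ˡ : ∀ i → σ (i ↑ˡ n) ≡ 1#
  σ-↑ˡ i = ≡.cong [ const 1# , const (- 1#) ]′ (splitAt-↑ˡ n i n)

  σ-↑ʳ : ∀ i → σ (n ↑ʳ i) ≡ - 1#
  σ-↑ʳ i = ≡.cong [ const 1# , const (- 1#) ]′ (splitAt-↑ʳ n n i)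

  σ² : ∀ p → σ p * σ p ≈ 1#
  σ² p with splitAt n p
  ... | inj₁ _ = *-identityʳ 1#
  ... | inj₂ _ = solve 0 (:- con (+ 1) :* :- con (+ 1) := con (+ 1)) refl

  -- The block matrix with U + V on the diagonal and U - V off it, acting
  -- as 2U on the vectors (u , u) and as 2V on the vectors (u , -u).
  T : Matrix n n → Matrix n n → Matrix (n ℕ.+ n) (n ℕ.+ n)
  T U V p q = U (base p) (base q) + σ p * σ q * V (base p) (base q)

  T-cong : ∀ {U U′ V V′} → U ≋ U′ → V ≋ V′ → T U V ≋ T U′ V′
  T-cong U≋U′ V≋V′ p q = +-cong (U≋U′ (base p) (base q)) (*-congˡ (V≋V′ (base p) (base q)))

  T-symmetric : ∀ {U V} → transpose U ≋ U → transpose V ≋ V → transpose (T U V) ≋ T U V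
  T-symmetric Uᵀ≋U Vᵀ≋V p q = +-cong (Uᵀ≋U (base p) (base q)) (*-cong (*-comm _ _) (Vᵀ≋V (base p) (base q)))

  sum-base : ∀ (f : Carrier → Fin n → Carrier) →
    sum (λ p → f (σ p) (base p)) ≈ sum (λ k → f 1# k + f (- 1#) k)
  sum-base f = begin
    sum (λ p → f (σ p) (base p))
      ≈⟨ sum-split n (λ p → f (σ p) (base p)) ⟩
    sum (λ k → f (σ (k ↑ˡ n)) (base (k ↑ˡ n))) + sum (λ k → f (σ (n ↑ʳ k)) (base (n ↑ʳ k)))
      ≈⟨ +-cong (sum-cong-≋ λ k → reflexive (≡.cong₂ f (σ-↑ˡ k) (base-↑ˡ k)))
                (sum-cong-≋ λ k → reflexive (≡.cong₂ f (σ-↑ʳ k) (base-↑ʳ k))) ⟩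
    sum (f 1#) + sum (f (- 1#))  ≈⟨ ∑-distrib-+ (f 1#) (f (- 1#)) ⟨
    sum (λ k → f 1# k + f (- 1#) k)  ∎

  T-⊗ : ∀ U V U′ V′ → T U V ⊗ T U′ V′ ≋ fromℕ 2 · T (U ⊗ U′) (V ⊗ V′)
  T-⊗ U V U′ V′ p q = begin
    sum (λ s → (U i (base s) + σ p * σ s * V i (base s)) * (U′ (base s) j + σ s * σ q * V′ (base s) j))
      ≈⟨ sum-base (λ τ k → (U i k + σ p * τ * V i k) * (U′ k j + τ * σ q * V′ k j)) ⟩
    sum (λ k → (U i k + σ p * 1# * V i k) * (U′ k j + 1# * σ q * V′ k j)
             + (U i k + σ p * - 1# * V i k) * (U′ k j + - 1# * σ q * V′ k j))
      ≈⟨ sum-cong-≋ (λ k → solve 6 (λ u v u′ v′ s t →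
           (u :+ s :* con (+ 1) :* v) :* (u′ :+ con (+ 1) :* t :* v′)
             :+ (u :+ s :* :- con (+ 1) :* v) :* (u′ :+ :- con (+ 1) :* t :* v′)
           := con (+ 2) :* (u :* u′ :+ s :* t :* (v :* v′))) refl
           (U i k) (V i k) (U′ k j) (V′ k j) (σ p) (σ q)) ⟩
    sum (λ k → fromℕ 2 * (U i k * U′ k j + σ p * σ q * (V i k * V′ k j)))
      ≈⟨ *-distribˡ-sum (fromℕ 2) (λ k → U i k * U′ k j + σ p * σ q * (V i k * V′ k j)) ⟨
    fromℕ 2 * sum (λ k → U i k * U′ k j + σ p * σ q * (V i k * V′ k j))
      ≈⟨ *-congˡ (∑-distrib-+ (λ k → U i k * U′ k j) (λ k → σ p * σ q * (V i k * V′ k j))) ⟩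
    fromℕ 2 * ((U ⊗ U′) i j + sum (λ k → σ p * σ q * (V i k * V′ k j)))
      ≈⟨ *-congˡ (+-congˡ (*-distribˡ-sum (σ p * σ q) (λ k → V i k * V′ k j))) ⟨
    fromℕ 2 * T (U ⊗ U′) (V ⊗ V′) p q  ∎
    where
    i = base p
    j = base q

  moorePenrose-T : ∀ {U U† V V†} h → fromℕ 2 * (fromℕ 2 * h) ≈ 1# →
    IsMoorePenrose U U† → IsMoorePenrose V V† → IsMoorePenrose (T U V) (h · T U† V†)
  moorePenrose-T {U} {U†} {V} {V†} h 4h≈1 mpU mpV = record
    { AA†A≋A   = λ p q → begin
        (T U V ⊗ (h · T U† V†) ⊗ T U V) p q             ≈⟨ ⊗-congʳ (T U V) AA† p q ⟩
        ((g · T (U ⊗ U†) (V ⊗ V†)) ⊗ T U V) p q         ≈⟨ ·-⊗ g (T (U ⊗ U†) (V ⊗ V†)) (T U V) p q ⟩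
        g * (T (U ⊗ U†) (V ⊗ V†) ⊗ T U V) p q           ≈⟨ *-congˡ (T-⊗ (U ⊗ U†) (V ⊗ V†) U V p q) ⟩
        g * (fromℕ 2 * T (U ⊗ U† ⊗ U) (V ⊗ V† ⊗ V) p q) ≈⟨ cancel _ ⟩
        T (U ⊗ U† ⊗ U) (V ⊗ V† ⊗ V) p q                 ≈⟨ T-cong U.AA†A≋A V.AA†A≋A p q ⟩
        T U V p q                                       ∎
    ; A†AA†≋A† = λ p q → begin
        ((h · T U† V†) ⊗ T U V ⊗ (h · T U† V†)) p q     ≈⟨ ⊗-congʳ (h · T U† V†) A†A p q ⟩
        ((g · T (U† ⊗ U) (V† ⊗ V)) ⊗ (h · T U† V†)) p q ≈⟨ ⊗-· h (g · T (U† ⊗ U) (V† ⊗ V)) (T U† V†) p q ⟩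
        h * ((g · T (U† ⊗ U) (V† ⊗ V)) ⊗ T U† V†) p q   ≈⟨ *-congˡ (·-⊗ g (T (U† ⊗ U) (V† ⊗ V)) (T U† V†) p q) ⟩
        h * (g * (T (U† ⊗ U) (V† ⊗ V) ⊗ T U† V†) p q)   ≈⟨ *-congˡ (*-congˡ (T-⊗ (U† ⊗ U) (V† ⊗ V) U† V† p q)) ⟩
        h * (g * (fromℕ 2 * T (U† ⊗ U ⊗ U†) (V† ⊗ V ⊗ V†) p q)) ≈⟨ *-congˡ (cancel _) ⟩
        h * T (U† ⊗ U ⊗ U†) (V† ⊗ V ⊗ V†) p q           ≈⟨ *-congˡ (T-cong U.A†AA†≋A† V.A†AA†≋A† p q) ⟩
        h * T U† V† p q                                 ∎
    ; AA†-symm = λ p q → begin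
        (T U V ⊗ (h · T U† V†)) q p     ≈⟨ AA† q p ⟩
        g * T (U ⊗ U†) (V ⊗ V†) q p     ≈⟨ *-congˡ (T-symmetric U.AA†-symm V.AA†-symm p q) ⟩
        g * T (U ⊗ U†) (V ⊗ V†) p q     ≈⟨ AA† p q ⟨
        (T U V ⊗ (h · T U† V†)) p q     ∎
    ; A†A-symm = λ p q → begin
        ((h · T U† V†) ⊗ T U V) q p     ≈⟨ A†A q p ⟩
        g * T (U† ⊗ U) (V† ⊗ V) q p     ≈⟨ *-congˡ (T-symmetric U.A†A-symm V.A†A-symm p q) ⟩
        g * T (U† ⊗ U) (V† ⊗ V) p q     ≈⟨ A†A p q ⟨
        ((h · T U† V†) ⊗ T U V) p q     ∎
    }
    where
    module U = IsMoorePenrose mpU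
    module V = IsMoorePenrose mpV

    g : Carrier
    g = h * fromℕ 2

    AA† : T U V ⊗ (h · T U† V†) ≋ g · T (U ⊗ U†) (V ⊗ V†)
    AA† p q = trans (⊗-· h (T U V) (T U† V†) p q) (trans (*-congˡ (T-⊗ U V U† V† p q)) (sym (*-assoc _ _ _)))

    A†A : (h · T U† V†) ⊗ T U V ≋ g · T (U† ⊗ U) (V† ⊗ V)
    A†A p q = trans (·-⊗ h (T U† V†) (T U V) p q) (trans (*-congˡ (T-⊗ U† V† U V p q)) (sym (*-assoc _ _ _)))

    cancel : ∀ x → g * (fromℕ 2 * x) ≈ x
    cancel x = begin
      h * fromℕ 2 * (fromℕ 2 * x)
        ≈⟨ solve 3 (λ h t x → h :* t :* (t :* x) := t :* (t :* h) :* x) refl h (fromℕ 2) x ⟩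
      fromℕ 2 * (fromℕ 2 * h) * x    ≈⟨ *-congʳ 4h≈1 ⟩
      1# * x                         ≈⟨ *-identityˡ x ⟩
      x                              ∎

  -- The identity matrix on the two copies is half of T δ δ.
  2δ : ∀ p q → fromℕ 2 * δ p q ≈ T δ δ p q
  2δ = elim-+ n _ (λ i → elim-+ n _ (same (_↑ˡ n) (↑ˡ-injective n) 1# base-↑ˡ σ-↑ˡ 1*1 i)
                                     (λ j → other i j (λ eq → ↑ˡ≢↑ʳ i j eq) (base-↑ˡ i) (base-↑ʳ j) (σ-↑ˡ i) (σ-↑ʳ j) (*-identityˡ _)))
                  (λ i → elim-+ n _ (λ j → other i j (λ eq → ↑ˡ≢↑ʳ j i (≡.sym eq)) (base-↑ʳ i) (base-↑ˡ j) (σ-↑ʳ i) (σ-↑ˡ j) (*-identityʳ _))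
                                     (same (n ↑ʳ_) (↑ʳ-injective n) (- 1#) base-↑ʳ σ-↑ʳ -1*-1 i))
    where
    1*1 : 1# * 1# ≈ 1#
    1*1 = *-identityˡ 1#

    -1*-1 : - 1# * - 1# ≈ 1#
    -1*-1 = solve 0 (:- con (+ 1) :* :- con (+ 1) := con (+ 1)) refl

    same : ∀ (f : Fin n → Fin (n ℕ.+ n)) → (∀ i j → f i ≡ f j → i ≡ j) → ∀ s → (∀ i → base (f i) ≡ i) →
      (∀ i → σ (f i) ≡ s) → s * s ≈ 1# → ∀ i j → fromℕ 2 * δ (f i) (f j) ≈ T δ δ (f i) (f j)
    same f f-inj s base-f σ-f ss≈1 i j rewrite base-f i | base-f j | σ-f i | σ-f j = begin
      fromℕ 2 * δ (f i) (f j)     ≈⟨ *-congˡ (δ-injective f f-inj i j) ⟩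
      fromℕ 2 * δ i j             ≈⟨ solve 1 (λ d → con (+ 2) :* d := d :+ con (+ 1) :* d) refl (δ i j) ⟩
      δ i j + 1# * δ i j          ≈⟨ +-congˡ (*-congʳ ss≈1) ⟨
      δ i j + s * s * δ i j       ∎

    other : ∀ {p q s t} i j → p ≢ q → base p ≡ i → base q ≡ j → σ p ≡ s → σ q ≡ t → s * t ≈ - 1# →
      fromℕ 2 * δ p q ≈ T δ δ p q
    other {p} {q} {s} {t} i j p≢q ≡.refl ≡.refl ≡.refl ≡.refl st≈-1 = begin
      fromℕ 2 * δ p q                                ≈⟨ *-congˡ (δ-≢ p≢q) ⟩
      fromℕ 2 * 0#
        ≈⟨ solve 1 (λ d → con (+ 2) :* con (+ 0) := d :+ :- con (+ 1) :* d) refl (δ i j) ⟩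
      δ i j + - 1# * δ i j                           ≈⟨ +-congˡ (*-congʳ st≈-1) ⟨
      δ i j + σ p * σ q * δ i j                      ∎

-- Products

module Products {c ℓ₁ ℓ₂ : Level} (F : OrderedField c ℓ₁ ℓ₂) where

  open Base F
  open SumSplit *-commutativeMonoid public using () renaming (sum-split to product-split)
  open import Algebra.Properties.CommutativeMonoid.Sum *-commutativeMonoid public using ()
    renaming (sum-cong-≋ to product-cong; ∑-distrib-+ to product-distrib-*)

  product-one : ∀ n → product {n} (λ _ → 1#) ≈ 1#
  product-one zero    = refl
  product-one (suc n) = trans (*-identityˡ _) (product-one n)

-- The determinant of a block matrix

module TwinDeterminant {c ℓ₁ ℓ₂ : Level} (F : OrderedField c ℓ₁ ℓ₂) {n : ℕ} where

  open Base F
  open Determinants F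
  open Scalars F
  open Twins F n
  open Products F

  -- With P = U + vI and Q = U - vI, the row operations are
  --   P Q      2vI -2vI      I -I      I -I
  --   Q P  to  Q    P    to  Q  P  to  0 2U,
  -- where the second step takes the factor 2v out of each upper row.  The last two
  -- matrices are B and B′, and s lists the factors.
  det-T : ∀ (U : Matrix n n) v →
    det (T U (v · δ)) ≈ product {n} (λ _ → v + v) * det (λ i j → U i j + U i j)
  det-T U v = begin
    det A  ≈⟨ det-addRows (n ↑ʳ_) C₁ (λ a b → trans (-‿cong (δ-≢ (↑ˡ≢↑ʳ a b))) -0#≈0#) A ⟨
    det (λ p q → A p q + sum (λ a → C₁ a p * A (n ↑ʳ a) q))  ≈⟨ det-cong step₁ ⟩
    det (λ p q → s p * B p q)    ≈⟨ det-scaleRows s B ⟩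
    product s * det B
      ≈⟨ *-cong product-s (sym (det-addRows (_↑ˡ n) C₂ (λ a b → reflexive (lookup-++ˡ (replicate n 0#) (C a) b)) B)) ⟩
    product {n} (λ _ → y) * det B′  ≈⟨ *-congˡ (det-blockUpper n B′ left) ⟩
    product {n} (λ _ → y) * det (λ i j → B′ (n ↑ʳ i) (n ↑ʳ j))  ≈⟨ *-congˡ (det-cong right) ⟩
    product {n} (λ _ → y) * det (λ i j → U i j + U i j)  ∎
    where
    A : Matrix (n ℕ.+ n) (n ℕ.+ n)
    A = T U (v · δ)

    y : Carrier
    y = v + v

    -- The off-diagonal block.
    Q : Matrix n n
    Q i j = U i j - v * δ i j

    A-entry : ∀ {p q i j s t} → base p ≡ i → base q ≡ j → σ p ≡ s → σ q ≡ t →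
      A p q ≈ U i j + s * t * (v * δ i j)
    A-entry ≡.refl ≡.refl ≡.refl ≡.refl = refl

    A-top : ∀ i q → A (i ↑ˡ n) q ≈ U i (base q) + 1# * σ q * (v * δ i (base q))
    A-top i q = A-entry (base-↑ˡ i) ≡.refl (σ-↑ˡ i) ≡.refl

    A-bottom : ∀ i q → A (n ↑ʳ i) q ≈ U i (base q) + - 1# * σ q * (v * δ i (base q))
    A-bottom i q = A-entry (base-↑ʳ i) ≡.refl (σ-↑ʳ i) ≡.refl

    -- The lower rows are subtracted from the upper ones.
    C₁ : Fin n → Vector Carrier (n ℕ.+ n)
    C₁ a p = - δ (a ↑ˡ n) p

    s : Vector Carrier (n ℕ.+ n)
    s = replicate n y ++ replicate n 1#

    B : Matrix (n ℕ.+ n) (n ℕ.+ n)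
    B = (λ i q → σ q * δ i (base q)) ++ (λ i → A (n ↑ʳ i))

    B-top : ∀ i q → B (i ↑ˡ n) q ≈ σ q * δ i (base q)
    B-top i q = reflexive (≡.cong (λ r → r q) (lookup-++ˡ (λ i q → σ q * δ i (base q)) (λ i → A (n ↑ʳ i)) i))

    B-bottom : ∀ i q → B (n ↑ʳ i) q ≈ A (n ↑ʳ i) q
    B-bottom i q = reflexive (≡.cong (λ r → r q) (lookup-++ʳ (λ i q → σ q * δ i (base q)) (λ i → A (n ↑ʳ i)) i))

    step₁ : (λ p q → A p q + sum (λ a → C₁ a p * A (n ↑ʳ a) q)) ≋ (λ p q → s p * B p q)
    step₁ p q = elim-+ n (λ p → A p q + sum (λ a → C₁ a p * A (n ↑ʳ a) q) ≈ s p * B p q) top bottom p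
      where
      top : ∀ i → A (i ↑ˡ n) q + sum (λ a → C₁ a (i ↑ˡ n) * A (n ↑ʳ a) q) ≈ s (i ↑ˡ n) * B (i ↑ˡ n) q
      top i = begin
        A (i ↑ˡ n) q + sum (λ a → - δ (a ↑ˡ n) (i ↑ˡ n) * A (n ↑ʳ a) q)
          ≈⟨ +-cong (A-top i q) (sum-cong-≋ λ a → begin
               - δ (a ↑ˡ n) (i ↑ˡ n) * A (n ↑ʳ a) q
                 ≈⟨ *-congʳ (-‿cong (trans (δ-injective (_↑ˡ n) (↑ˡ-injective n) a i) (δ-sym a i))) ⟩
               - δ i a * A (n ↑ʳ a) q
                 ≈⟨ solve 2 (λ d x → :- d :* x := d :* :- x) refl (δ i a) (A (n ↑ʳ a) q) ⟩
               δ i a * - A (n ↑ʳ a) q ∎) ⟩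
        U i (base q) + 1# * σ q * (v * δ i (base q)) + sum (λ a → δ i a * - A (n ↑ʳ a) q)
          ≈⟨ +-congˡ (trans (sum-δ i (λ a → - A (n ↑ʳ a) q)) (-‿cong (A-bottom i q))) ⟩
        U i (base q) + 1# * σ q * (v * δ i (base q)) - (U i (base q) + - 1# * σ q * (v * δ i (base q)))
          ≈⟨ solve 4 (λ u t v d → u :+ con (+ 1) :* t :* (v :* d) :- (u :+ :- con (+ 1) :* t :* (v :* d))
                := (v :+ v) :* (t :* d)) refl (U i (base q)) (σ q) v (δ i (base q)) ⟩
        y * (σ q * δ i (base q))
          ≈⟨ *-cong (reflexive (lookup-++ˡ (replicate n y) (replicate n 1#) i)) (B-top i q) ⟨
        s (i ↑ˡ n) * B (i ↑ˡ n) q  ∎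

      bottom : ∀ i → A (n ↑ʳ i) q + sum (λ a → C₁ a (n ↑ʳ i) * A (n ↑ʳ a) q) ≈ s (n ↑ʳ i) * B (n ↑ʳ i) q
      bottom i = begin
        A (n ↑ʳ i) q + sum (λ a → C₁ a (n ↑ʳ i) * A (n ↑ʳ a) q)
          ≈⟨ +-congˡ (sum-zero {f = λ a → C₁ a (n ↑ʳ i) * A (n ↑ʳ a) q} λ a → trans (*-congʳ (trans (-‿cong (δ-≢ (↑ˡ≢↑ʳ a i))) -0#≈0#)) (zeroˡ _)) ⟩
        A (n ↑ʳ i) q + 0#   ≈⟨ trans (+-identityʳ _) (sym (*-identityˡ _)) ⟩
        1# * A (n ↑ʳ i) q
          ≈⟨ *-cong (reflexive (lookup-++ʳ (replicate n y) (replicate n 1#) i)) (B-bottom i q) ⟨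
        s (n ↑ʳ i) * B (n ↑ʳ i) q  ∎

    product-s : product s ≈ product {n} (λ _ → y)
    product-s = begin
      product s ≈⟨ product-split n s ⟩
      product (s ∘ (_↑ˡ n)) * product (s ∘ (n ↑ʳ_))
        ≈⟨ *-cong (product-cong λ i → reflexive (lookup-++ˡ (replicate n y) (replicate n 1#) i))
                  (product-cong λ i → reflexive (lookup-++ʳ (replicate n y) (replicate n 1#) i)) ⟩
      product {n} (λ _ → y) * product {n} (λ _ → 1#)  ≈⟨ *-congˡ (product-one n) ⟩
      product {n} (λ _ → y) * 1#                      ≈⟨ *-identityʳ _ ⟩
      product {n} (λ _ → y)                           ∎

    C : Fin n → Vector Carrier n
    C a i = - Q i a

    -- Q times the upper rows is subtracted from the lower ones.
    C₂ : Fin n → Vector Carrier (n ℕ.+ n)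
    C₂ a = replicate n 0# ++ C a

    B′ : Matrix (n ℕ.+ n) (n ℕ.+ n)
    B′ p q = B p q + sum λ a → C₂ a p * B (a ↑ˡ n) q

    B′-top : ∀ i q → B′ (i ↑ˡ n) q ≈ σ q * δ i (base q)
    B′-top i q = trans
      (+-cong (B-top i q) (sum-zero λ a → trans (*-congʳ (reflexive (lookup-++ˡ (replicate n 0#) (C a) i))) (zeroˡ _)))
      (+-identityʳ _)

    B′-bottom : ∀ i q → B′ (n ↑ʳ i) q ≈ U i (base q) - σ q * (v * δ i (base q)) - σ q * Q i (base q)
    B′-bottom i q = +-cong
      (trans (B-bottom i q) (trans (A-bottom i q)
        (solve 3 (λ u t x → u :+ :- con (+ 1) :* t :* x := u :- t :* x) refl (U i (base q)) (σ q) (v * δ i (base q)))))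
      (begin
        sum (λ a → C₂ a (n ↑ʳ i) * B (a ↑ˡ n) q)
          ≈⟨ sum-cong-≋ (λ a → begin
               C₂ a (n ↑ʳ i) * B (a ↑ˡ n) q
                 ≈⟨ *-cong (reflexive (lookup-++ʳ (replicate n 0#) (C a) i)) (B-top a q) ⟩
               - Q i a * (σ q * δ a (base q))    ≈⟨ *-congˡ (*-congˡ (δ-sym a (base q))) ⟩
               - Q i a * (σ q * δ (base q) a)
                 ≈⟨ solve 3 (λ x t d → :- x :* (t :* d) := d :* :- (t :* x)) refl (Q i a) (σ q) (δ (base q) a) ⟩
               δ (base q) a * - (σ q * Q i a)    ∎) ⟩
        sum (λ a → δ (base q) a * - (σ q * Q i a))  ≈⟨ sum-δ (base q) (λ a → - (σ q * Q i a)) ⟩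
        - (σ q * Q i (base q))                      ∎)

    left : ∀ p a → B′ p (a ↑ˡ n) ≈ δ p (a ↑ˡ n)
    left p a = elim-+ n (λ p → B′ p (a ↑ˡ n) ≈ δ p (a ↑ˡ n)) top bottom p
      where
      top : ∀ i → B′ (i ↑ˡ n) (a ↑ˡ n) ≈ δ (i ↑ˡ n) (a ↑ˡ n)
      top i = begin
        B′ (i ↑ˡ n) (a ↑ˡ n)                ≈⟨ B′-top i (a ↑ˡ n) ⟩
        σ (a ↑ˡ n) * δ i (base (a ↑ˡ n))    ≡⟨ ≡.cong₂ (λ t j → t * δ i j) (σ-↑ˡ a) (base-↑ˡ a) ⟩
        1# * δ i a                          ≈⟨ *-identityˡ _ ⟩
        δ i a                               ≈⟨ δ-injective (_↑ˡ n) (↑ˡ-injective n) i a ⟨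
        δ (i ↑ˡ n) (a ↑ˡ n)                 ∎

      bottom : ∀ i → B′ (n ↑ʳ i) (a ↑ˡ n) ≈ δ (n ↑ʳ i) (a ↑ˡ n)
      bottom i = begin
        B′ (n ↑ʳ i) (a ↑ˡ n)
          ≈⟨ B′-bottom i (a ↑ˡ n) ⟩
        U i (base (a ↑ˡ n)) - σ (a ↑ˡ n) * (v * δ i (base (a ↑ˡ n))) - σ (a ↑ˡ n) * Q i (base (a ↑ˡ n))
          ≡⟨ ≡.cong₂ (λ t j → U i j - t * (v * δ i j) - t * Q i j) (σ-↑ˡ a) (base-↑ˡ a) ⟩
        U i a - 1# * (v * δ i a) - 1# * (U i a - v * δ i a)
          ≈⟨ solve 2 (λ u x → u :- con (+ 1) :* x :- con (+ 1) :* (u :- x) := con (+ 0)) refl (U i a) (v * δ i a) ⟩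
        0#
          ≈⟨ δ-≢ (↑ˡ≢↑ʳ a i ∘ ≡.sym) ⟨
        δ (n ↑ʳ i) (a ↑ˡ n)  ∎

    right : (λ i j → B′ (n ↑ʳ i) (n ↑ʳ j)) ≋ (λ i j → U i j + U i j)
    right i j = begin
      B′ (n ↑ʳ i) (n ↑ʳ j)
        ≈⟨ B′-bottom i (n ↑ʳ j) ⟩
      U i (base (n ↑ʳ j)) - σ (n ↑ʳ j) * (v * δ i (base (n ↑ʳ j))) - σ (n ↑ʳ j) * Q i (base (n ↑ʳ j))
        ≡⟨ ≡.cong₂ (λ t j → U i j - t * (v * δ i j) - t * Q i j) (σ-↑ʳ j) (base-↑ʳ j) ⟩
      U i j - - 1# * (v * δ i j) - - 1# * (U i j - v * δ i j)
        ≈⟨ solve 2 (λ u x → u :- :- con (+ 1) :* x :- :- con (+ 1) :* (u :- x) := u :+ u) refl (U i j) (v * δ i j) ⟩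
      U i j + U i j  ∎

-- Matrices with constant column sums

module ColumnSums {c ℓ₁ ℓ₂ : Level} (F : OrderedField c ℓ₁ ℓ₂) where

  open Base F
  open Determinants F

  -- The first row replaced by the all-ones vector.
  onesRow : ∀ {n} → Matrix (suc n) (suc n) → Matrix (suc n) (suc n)
  onesRow A zero    j = 1#
  onesRow A (suc i) j = A (suc i) j

  det-columnSums : ∀ {n} (A : Matrix (suc n) (suc n)) s → (∀ j → sum (λ i → A i j) ≈ s) →
    det A ≈ s * det (onesRow A)
  det-columnSums {n} A s col = begin
    det A  ≈⟨ det-addRows suc (λ _ → 1# ∷ replicate n 0#) (λ _ _ → refl) A ⟨
    det (λ i j → A i j + sum (λ a → (1# ∷ replicate n 0#) i * A (suc a) j))
      ≈⟨ det-cong {A = λ i j → A i j + sum (λ a → (1# ∷ replicate n 0#) i * A (suc a) j)}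
                  {B = λ i j → (s ∷ replicate n 1#) i * onesRow A i j}
                  (λ { zero    j → begin
                         A zero j + sum (λ a → 1# * A (suc a) j)
                           ≈⟨ +-congˡ (sum-cong-≋ λ a → *-identityˡ (A (suc a) j)) ⟩
                         sum (λ i → A i j)                        ≈⟨ col j ⟩
                         s                                        ≈⟨ *-identityʳ s ⟨
                         s * 1#                                   ∎
                     ; (suc i) j → begin
                         A (suc i) j + sum (λ a → 0# * A (suc a) j)
                           ≈⟨ +-congˡ (sum-zero λ a → zeroˡ (A (suc a) j)) ⟩
                         A (suc i) j + 0#                            ≈⟨ +-identityʳ _ ⟩
                         A (suc i) j                                 ≈⟨ *-identityˡ _ ⟨
                         1# * A (suc i) j                            ∎ }) ⟩
    det (λ i j → (s ∷ replicate n 1#) i * onesRow A i j)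
      ≈⟨ det-scaleRows (s ∷ replicate n 1#) (onesRow A) ⟩
    s * product {n} (λ _ → 1#) * det (onesRow A)
      ≈⟨ *-congʳ (trans (*-congˡ (Products.product-one F n)) (*-identityʳ s)) ⟩
    s * det (onesRow A)  ∎

  det-onesRow-shift : ∀ {n} (A : Matrix (suc n) (suc n)) t →
    det (onesRow (λ i j → A i j - t)) ≈ det (onesRow A)
  det-onesRow-shift {n} A t = trans
    (det-cong {A = onesRow (λ i j → A i j - t)}
              {B = λ i j → onesRow A i j + (0# ∷ replicate n (- t)) i * onesRow A zero j}
      λ { zero    j → sym (trans (+-congˡ (zeroˡ 1#)) (+-identityʳ 1#))
                ; (suc i) j → +-congˡ (sym (*-identityʳ (- t))) })
    (det-addRow zero (0# ∷ replicate n (- t)) refl (onesRow A))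

-- The Perron root and its cofactor

-- R is a nonnegative symmetric matrix with constant row sums k and with
-- eigenvalues ρ in decreasing order.
module PerronRoot {c ℓ₁ ℓ₂ : Level} (F : OrderedField c ℓ₁ ℓ₂) {n : ℕ}
  (R : Over.Matrix F (suc n) (suc n))
  (R-sym : ∀ i j → Over._≈_ F (R i j) (R j i))
  (0≤R : ∀ i j → Over._≤_ F (Over.0# F) (R i j))
  (k : Over.Carrier F) (rowSum : Over.ResistanceRegular F R k)
  (ρ : Vector (Over.Carrier F) (suc n))
  (decreasing : Over.Decreasing F ρ) (eigenvalues : Over.Eigenvalues F R ρ) where

  open Base F
  open Order F
  open Determinants F
  open Positivity F
  open Polynomials F
  open ColumnSums F

  -- The matrix xI - R.
  charMatrix : Carrier → Matrix (suc n) (suc n)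
  charMatrix x i j = diagonal (λ _ → x) i j - R i j

  rowSum-charMatrix : ∀ x i → sum (charMatrix x i) ≈ x - k
  rowSum-charMatrix x i = begin
    sum (λ j → diagonal (λ _ → x) i j - R i j)
      ≈⟨ sum-distrib-- (λ j → diagonal (λ _ → x) i j) (R i) ⟩
    sum (λ j → diagonal (λ _ → x) i j) - sum (R i)
      ≈⟨ +-cong (trans (sum-cong-≋ (diagonal≈ (λ _ → x) i)) (sum-δ i (λ _ → x))) (-‿cong (rowSum i)) ⟩
    x - k  ∎

  charMatrix-sym : ∀ x i j → charMatrix x i j ≈ charMatrix x j i
  charMatrix-sym x i j = +-cong
    (trans (diagonal≈ (λ _ → x) i j) (trans (*-congʳ (δ-sym i j)) (sym (diagonal≈ (λ _ → x) j i))))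
    (-‿cong (R-sym i j))

  columnSum-charMatrix : ∀ x j → sum (λ i → charMatrix x i j) ≈ x - k
  columnSum-charMatrix x j = trans (sum-cong-≋ λ i → charMatrix-sym x i j) (rowSum-charMatrix x j)

  -- The cofactor of x - k in the characteristic polynomial of R.
  cofactor : Carrier → Carrier
  cofactor x = det (onesRow (charMatrix x))

  charpoly≈ : ∀ x → charpoly R x ≈ (x - k) * cofactor x
  charpoly≈ x = det-columnSums (charMatrix x) (x - k) (columnSum-charMatrix x)

  cofactor-poly : Poly (suc (suc n)) cofactor
  cofactor-poly = poly-cong (λ x → det-cong (entry x)) (poly-det A B)
    where
    A B : Matrix (suc n) (suc n)
    A zero    j = 0#
    A (suc i) j = δ (suc i) j
    B zero    j = 1#
    B (suc i) j = - R (suc i) j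

    entry : ∀ x → (λ i j → A i j * x + B i j) ≋ onesRow (charMatrix x)
    entry x zero    j = trans (+-congʳ (zeroˡ x)) (+-identityˡ 1#)
    entry x (suc i) j = +-congʳ (sym (diagonal≈ (λ _ → x) (suc i) j))

  -- The largest eigenvalue is the constant row sum.
  ρ₀≈k : ρ zero ≈ k
  ρ₀≈k = ≮≯⇒≈ ρ₀≮k k≮ρ₀
    where
    charpoly-k : charpoly R k ≈ 0#
    charpoly-k = trans (charpoly≈ k) (trans (*-congʳ (-‿inverseʳ k)) (zeroˡ _))

    charpoly-ρ₀ : charpoly R (ρ zero) ≈ 0#
    charpoly-ρ₀ = trans (eigenvalues (ρ zero)) (trans (*-congʳ (-‿inverseʳ (ρ zero))) (zeroˡ _))

    ρ₀≮k : ¬ (ρ zero < k)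
    ρ₀≮k ρ₀<k = <-irrefl (trans (sym charpoly-k) (eigenvalues k)) (0<product λ i →
      <-respʳ-≈ (solve 3 (λ k x y → k :- x :+ (x :- y) := k :- y) refl k (ρ zero) (ρ i))
        (0<0≤⇒0<+ (x<y⇒0<y-x ρ₀<k) (0≤ρ₀-ρ i)))
      where
      0≤ρ₀-ρ : ∀ i → 0# ≤ ρ zero - ρ i
      0≤ρ₀-ρ i ρ₀-ρᵢ<0 = decreasing {zero} {i} z≤n
        (<-resp (solve 2 (λ x y → x :- y :+ y := x) refl (ρ zero) (ρ i)) (+-identityˡ (ρ i))
          (+-monoˡ-< (ρ i) ρ₀-ρᵢ<0))

    k≮ρ₀ : ¬ (k < ρ zero)
    k≮ρ₀ k<ρ₀ = <-irrefl (sym charpoly-ρ₀) (0<det (charMatrix (ρ zero))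
      (λ {i} {j} i≢j → ≤-respʳ-≈ (begin
        R i j
          ≈⟨ solve 2 (λ x r → r := :- (con (+ 0) :* x :- r)) refl (ρ zero) (R i j) ⟩
        - (0# * ρ zero - R i j)                        ≈⟨ -‿cong (+-congʳ (*-congʳ (δ-≢ i≢j))) ⟨
        - (δ i j * ρ zero - R i j)                     ≈⟨ -‿cong (+-congʳ (diagonal≈ (λ _ → ρ zero) i j)) ⟨
        - charMatrix (ρ zero) i j                      ∎) (0≤R i j))
      (λ i → <-respʳ-≈ (sym (rowSum-charMatrix (ρ zero) i)) (x<y⇒0<y-x k<ρ₀)))

  cofactor≈ : ∀ x → cofactor x ≈ product (λ i → x - ρ (suc i))
  cofactor≈ x = begin
    cofactor x
      ≈⟨ solve 2 (λ f g → f := f :+ :- con (+ 1) :* g :+ g) refl (cofactor x) (rest x) ⟩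
    cofactor x + - 1# * rest x + rest x
      ≈⟨ +-congʳ (poly-vanish (poly-+ cofactor-poly (poly-scale (- 1#) (poly-mono (poly-product (ρ ∘ suc))))) k above x) ⟩
    0# + rest x
      ≈⟨ +-identityˡ _ ⟩
    rest x  ∎
    where
    rest : Carrier → Carrier
    rest x = product (λ i → x - ρ (suc i))

    above : ∀ x → k < x → cofactor x + - 1# * rest x ≈ 0#
    above x k<x = #0-cancel (0<⇒#0 (x<y⇒0<y-x k<x)) (begin
      (x - k) * (cofactor x + - 1# * rest x)
        ≈⟨ solve 3 (λ y f g → y :* (f :+ :- con (+ 1) :* g) := y :* f :- y :* g) refl (x - k) (cofactor x) (rest x) ⟩
      (x - k) * cofactor x - (x - k) * rest x
        ≈⟨ +-cong (trans (sym (charpoly≈ x)) (eigenvalues x)) (-‿cong (*-congʳ (+-congˡ (-‿cong (sym ρ₀≈k))))) ⟩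
      (x - ρ zero) * rest x - (x - ρ zero) * rest x
        ≈⟨ -‿inverseʳ _ ⟩
      0#  ∎)

  -- The characteristic polynomial of R + tJ, where J is the all-ones matrix:
  -- only the eigenvalue belonging to the all-ones vector moves.
  det-shift : ∀ x t → det (λ i j → charMatrix x i j - t) ≈
    (x - ρ zero - fromℕ (suc n) * t) * product (λ i → x - ρ (suc i))
  det-shift x t = begin
    det (λ i j → charMatrix x i j - t)
      ≈⟨ det-columnSums (λ i j → charMatrix x i j - t) (x - ρ zero - fromℕ (suc n) * t) column ⟩
    (x - ρ zero - fromℕ (suc n) * t) * det (onesRow (λ i j → charMatrix x i j - t))
      ≈⟨ *-congˡ (trans (det-onesRow-shift (charMatrix x) t) (cofactor≈ x)) ⟩
    (x - ρ zero - fromℕ (suc n) * t) * product (λ i → x - ρ (suc i))  ∎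
    where
    sum-const : ∀ m → sum {m} (λ _ → t) ≈ fromℕ m * t
    sum-const zero    = sym (zeroˡ t)
    sum-const (suc m) = trans (+-cong (sym (*-identityˡ t)) (sum-const m)) (sym (distribʳ t 1# (fromℕ m)))

    column : ∀ j → sum (λ i → charMatrix x i j - t) ≈ x - ρ zero - fromℕ (suc n) * t
    column j = begin
      sum (λ i → charMatrix x i j - t)
        ≈⟨ sum-distrib-- (λ i → charMatrix x i j) (λ _ → t) ⟩
      sum (λ i → charMatrix x i j) - sum {suc n} (λ _ → t)
        ≈⟨ +-cong (trans (columnSum-charMatrix x j) (+-congˡ (-‿cong (sym ρ₀≈k)))) (-‿cong (sum-const (suc n))) ⟩
      x - ρ zero - fromℕ (suc n) * t  ∎

-- Division by natural numbers

module Reciprocal {c ℓ₁ ℓ₂ : Level} (F : OrderedField c ℓ₁ ℓ₂) where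

  open Base F

  /≈* : ∀ x m .{{_ : NonZero m}} → x / m ≈ x * (1# / m)
  /≈* x m = *-congˡ (sym (*-identityˡ _))

  m*1/m≈1 : ∀ m .{{_ : NonZero m}} → fromℕ m * (1# / m) ≈ 1#
  m*1/m≈1 m = trans
    (solve 2 (λ a b → a :* (con (+ 1) :* b) := (a :- con (+ 0)) :* b) refl (fromℕ m) (proj₁ inverse))
    (proj₂ (proj₂ inverse))
    where
    inverse = #⇒invertible (#-sym (<⇒# (0<fromℕ m)))

-- The double graph

module DoubleGraph {c ℓ₁ ℓ₂ : Level} (F : OrderedField c ℓ₁ ℓ₂) {n : ℕ} (G : Graph n)
  (r : ℕ) (regular : Graph.Regular G r) where

  open Base F
  open Order F
  open MoorePenrose F
  open Scalars F
  open Twins F n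
  open Resistance F

  adjacency-D₂ : ∀ p q → adjacency (D₂ G) p q ≈ adjacency G (base p) (base q)
  adjacency-D₂ p q = reflexive (≡.cong (if_then 1# else 0#) (adj-D₂ (splitAt n p) (splitAt n q)))
    where
    adj-D₂ : ∀ x y → doubleAdj G x y ≡ Graph.adj G ([ id , id ]′ x) ([ id , id ]′ y)
    adj-D₂ (inj₁ i) (inj₁ j) = ≡.refl
    adj-D₂ (inj₁ i) (inj₂ j) = Graph.sym G j i
    adj-D₂ (inj₂ i) (inj₁ j) = ≡.refl
    adj-D₂ (inj₂ i) (inj₂ j) = ≡.refl

  degree-D₂ : ∀ p → fromℕ (Graph.degree (D₂ G) p) ≈ fromℕ 2 * fromℕ r
  degree-D₂ p = begin
    fromℕ (Graph.degree (D₂ G) p)                ≈⟨ degree≈sum (D₂ G) p ⟩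
    sum (adjacency (D₂ G) p)                     ≈⟨ sum-cong-≋ (adjacency-D₂ p) ⟩
    sum (λ q → adjacency G (base p) (base q))    ≈⟨ sum-base (λ _ → adjacency G (base p)) ⟩
    sum (λ k → adjacency G (base p) k + adjacency G (base p) k)
      ≈⟨ ∑-distrib-+ (adjacency G (base p)) (adjacency G (base p)) ⟩
    sum (adjacency G (base p)) + sum (adjacency G (base p))
      ≈⟨ +-cong row row ⟩
    fromℕ r + fromℕ r                            ≈⟨ solve 1 (λ r → r :+ r := con (+ 2) :* r) refl (fromℕ r) ⟩
    fromℕ 2 * fromℕ r                            ∎
    where
    row : sum (adjacency G (base p)) ≈ fromℕ r
    row = trans (sym (degree≈sum G (base p))) (reflexive (≡.cong fromℕ (regular (base p))))

  laplacian-D₂ : laplacian (D₂ G) ≋ T (laplacian G) (fromℕ r · δ)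
  laplacian-D₂ p q = begin
    diagonal (fromℕ ∘ Graph.degree (D₂ G)) p q - adjacency (D₂ G) p q
      ≈⟨ +-cong (diagonal≈ (fromℕ ∘ Graph.degree (D₂ G)) p q) (-‿cong (adjacency-D₂ p q)) ⟩
    δ p q * fromℕ (Graph.degree (D₂ G) p) - a
      ≈⟨ +-congʳ (*-congˡ (degree-D₂ p)) ⟩
    δ p q * (fromℕ 2 * fromℕ r) - a
      ≈⟨ +-congʳ (solve 3 (λ d t r → d :* (t :* r) := t :* d :* r) refl (δ p q) (fromℕ 2) (fromℕ r)) ⟩
    fromℕ 2 * δ p q * fromℕ r - a
      ≈⟨ +-congʳ (*-congʳ (2δ p q)) ⟩
    T δ δ p q * fromℕ r - a
      ≈⟨ solve 4 (λ d s r a → (d :+ s :* d) :* r :- a := d :* r :- a :+ s :* (r :* d)) refl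
           (δ i j) (σ p * σ q) (fromℕ r) a ⟩
    δ i j * fromℕ r - a + σ p * σ q * (fromℕ r * δ i j)
      ≈⟨ +-congʳ (+-congʳ (*-congˡ (reflexive (≡.cong fromℕ (regular i))))) ⟨
    δ i j * fromℕ (Graph.degree G i) - a + σ p * σ q * (fromℕ r * δ i j)
      ≈⟨ +-congʳ (+-congʳ (diagonal≈ (fromℕ ∘ Graph.degree G) i j)) ⟨
    T (laplacian G) (fromℕ r · δ) p q  ∎
    where
    i = base p
    j = base q
    a = adjacency G i j

  scalar-⊗ : ∀ a b → (a · δ {n}) ⊗ (b · δ) ≋ (a * b) · δ
  scalar-⊗ a b i j = begin
    sum (λ k → a * δ i k * (b * δ k j))
      ≈⟨ sum-cong-≋ (λ k → solve 4 (λ a d b e → a :* d :* (b :* e) := d :* (a :* b :* e)) refl a (δ i k) b (δ k j)) ⟩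
    sum (λ k → δ i k * (a * b * δ k j))  ≈⟨ sum-δ i (λ k → a * b * δ k j) ⟩
    a * b * δ i j                        ∎

  moorePenrose-scalar : ∀ a b → a * b ≈ 1# → IsMoorePenrose (a · δ {n}) (b · δ)
  moorePenrose-scalar a b ab≈1 = record
    { AA†A≋A   = triple a b ab≈1
    ; A†AA†≋A† = triple b a (trans (*-comm b a) ab≈1)
    ; AA†-symm = symmetric a b
    ; A†A-symm = symmetric b a
    }
    where
    triple : ∀ a b → a * b ≈ 1# → (a · δ) ⊗ (b · δ) ⊗ (a · δ) ≋ a · δ
    triple a b ab≈1 i j = begin
      ((a · δ) ⊗ (b · δ) ⊗ (a · δ)) i j  ≈⟨ ⊗-congʳ (a · δ) (scalar-⊗ a b) i j ⟩
      (((a * b) · δ) ⊗ (a · δ)) i j      ≈⟨ scalar-⊗ (a * b) a i j ⟩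
      a * b * a * δ i j                  ≈⟨ *-congʳ (trans (*-congʳ ab≈1) (*-identityˡ a)) ⟩
      a * δ i j                          ∎

    symmetric : ∀ a b → transpose ((a · δ) ⊗ (b · δ)) ≋ (a · δ) ⊗ (b · δ)
    symmetric a b i j = trans (scalar-⊗ a b j i) (trans (*-congˡ (δ-sym j i)) (sym (scalar-⊗ a b i j)))

  -- The resistance matrix of the double graph is R / 4 + J / 2r within each
  -- block, with I / 2r subtracted on the diagonal blocks and added on the
  -- other two.  Here h is one half and u is 1 / r.
  resistance-D₂ : ∀ {R : Matrix n n} {R′ : Matrix (n ℕ.+ n) (n ℕ.+ n)} →
    IsResistanceMatrix G R → IsResistanceMatrix (D₂ G) R′ →
    ∀ h u → fromℕ 2 * h ≈ 1# → fromℕ r * u ≈ 1# →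
    R′ ≋ T (λ i j → h * (h * R i j + u)) ((- (h * u)) · δ)
  resistance-D₂ {R} {R′} res res′ h u 2h≈1 ru≈1 p q = begin
    R′ p q
      ≈⟨ R′.resistance p q ⟩
    R′.L† p p + R′.L† q q - fromℕ 2 * R′.L† p q
      ≈⟨ +-cong (+-cong (trans (L†′≋ p p) (onDiagonal p)) (trans (L†′≋ q q) (onDiagonal q)))
                (-‿cong (*-congˡ (L†′≋ p q))) ⟩
    h * h * (R.L† i i + u) + h * h * (R.L† j j + u) - fromℕ 2 * (h * h * (R.L† i j + s * (u * δ i j)))
      ≈⟨ solve 7 (λ h u x y z s d →
           h :* h :* (x :+ u) :+ h :* h :* (y :+ u) :- con (+ 2) :* (h :* h :* (z :+ s :* (u :* d)))
           := h :* (h :* (x :+ y :- con (+ 2) :* z)) :+ (con (+ 2) :* h) :* (h :* u) :+ s :* (:- (h :* u) :* d) :* (con (+ 2) :* h))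
           refl h u (R.L† i i) (R.L† j j) (R.L† i j) s (δ i j) ⟩
    h * (h * (R.L† i i + R.L† j j - fromℕ 2 * R.L† i j)) + fromℕ 2 * h * (h * u) + s * (- (h * u) * δ i j) * (fromℕ 2 * h)
      ≈⟨ +-cong (+-cong (*-congˡ (*-congˡ (sym (R.resistance i j)))) (trans (*-congʳ 2h≈1) (*-identityˡ _)))
                (trans (*-congˡ 2h≈1) (*-identityʳ _)) ⟩
    h * (h * R i j) + h * u + s * (- (h * u) * δ i j)
      ≈⟨ +-congʳ (distribˡ h (h * R i j) u) ⟨
    h * (h * R i j + u) + s * (- (h * u) * δ i j)  ∎
    where
    module R  = IsResistanceMatrix res
    module R′ = IsResistanceMatrix res′
    i = base p
    j = base q
    s = σ p * σ q

    L†′≋ : R′.L† ≋ (h * h) · T R.L† (u · δ)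
    L†′≋ = moorePenrose-unique R′.isMoorePenrose
      (moorePenrose-congˡ (≋-sym laplacian-D₂)
        (moorePenrose-T (h * h)
          (trans (solve 2 (λ t h → t :* (t :* (h :* h)) := (t :* h) :* (t :* h)) refl (fromℕ 2) h)
            (trans (*-cong 2h≈1 2h≈1) (*-identityˡ 1#)))
          R.isMoorePenrose (moorePenrose-scalar (fromℕ r) u ru≈1)))

    onDiagonal : ∀ p → h * h * T R.L† (u · δ) p p ≈ h * h * (R.L† (base p) (base p) + u)
    onDiagonal p = *-congˡ (+-congˡ (trans (*-cong (σ² p) (trans (*-congˡ (δ-refl (base p))) (*-identityʳ u))) (*-identityˡ u)))

-- The spectrum of the double graph

theorem5p1 : ∀ {c ℓ₁ ℓ₂} (F : OrderedField c ℓ₁ ℓ₂) → let open Over F in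
    (m : ℕ) → let n = 2 ℕ.+ m in
    (G : Graph n) (conn : Graph.Connected G) →
    (r : ℕ) (reg : Graph.Regular G r) →
    (R : Matrix n n) → IsResistanceMatrix G R →
    (k : Carrier) → ResistanceRegular R k →
    (ρ : Vector Carrier n) → Decreasing ρ → Eigenvalues R ρ →
    (R′ : Matrix (n ℕ.+ n) (n ℕ.+ n)) → IsResistanceMatrix (D₂ G) R′ →
    let instance r≢0 = regular⇒nonZero G conn reg in
    Eigenvalues R′
    (((head ρ / 2 + fromℕ n / r) ∷ map (λ x → x / 2) (tail ρ))
    ++ replicate n (- (1# / r)))
theorem5p1 F m G conn r reg R res k resReg ρ decreasing eigenvalues R′ res′ x = begin
  charpoly R′ x
    ≈⟨ det-cong entries ⟩
  det (T U (v · δ))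
    ≈⟨ det-T U v ⟩
  product {n} (λ _ → v + v) * det (λ i j → U i j + U i j)
    ≈⟨ *-cong (product-cong {n} λ _ → antisymmetric) symmetric ⟩
  product {n} (λ _ → x - - u) * product (λ i → x - evenPart i)
    ≈⟨ *-comm _ _ ⟩
  product (λ i → x - evenPart i) * product {n} (λ _ → x - - u)
    ≈⟨ *-cong (product-cong {n} λ i → +-congˡ {x = x} (-‿cong (reflexive (lookup-++ˡ evenPart (replicate n (- u)) i))))
              (product-cong {n} λ i → +-congˡ {x = x} (-‿cong (reflexive (lookup-++ʳ evenPart (replicate n (- u)) i)))) ⟨
  product {n} (λ i → x - (evenPart ++ replicate n (- u)) (i ↑ˡ n)) * product {n} (λ i → x - (evenPart ++ replicate n (- u)) (n ↑ʳ i))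
    ≈⟨ product-split n (λ p → x - (evenPart ++ replicate n (- u)) p) ⟨
  product (λ p → x - (evenPart ++ replicate n (- u)) p)  ∎
  where
  open Base F
  open Determinants F
  open Scalars F
  open Twins F (2 ℕ.+ m)
  open TwinDeterminant F
  open Products F
  open Reciprocal F
  open Resistance F G using (resistance-sym; resistance-nonneg)
  open DoubleGraph F G r reg
  open PerronRoot F R (resistance-sym res) (resistance-nonneg res) k resReg ρ decreasing eigenvalues

  instance
    r≢0 : NonZero r
    r≢0 = regular⇒nonZero G conn reg

  n : ℕ
  n = 2 ℕ.+ m

  h u v : Carrier
  h = 1# / 2
  u = 1# / r
  v = h * (x + u)

  2h≈1 : fromℕ 2 * h ≈ 1#
  2h≈1 = m*1/m≈1 2

  -- The eigenvalues that belong to vectors of the form (w , w).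
  evenPart : Vector Carrier n
  evenPart = (head ρ / 2 + fromℕ n / r) ∷ map (λ x → x / 2) (tail ρ)

  -- The matrix (xI - R / 2 - uJ) / 2.
  U : Matrix n n
  U i j = h * (δ i j * x - (h * R i j + u))

  entries : (λ p q → diagonal (λ _ → x) p q - R′ p q) ≋ T U (v · δ)
  entries p q = begin
    diagonal (λ _ → x) p q - R′ p q
      ≈⟨ +-cong (diagonal≈ (λ _ → x) p q) (-‿cong (resistance-D₂ res res′ h u 2h≈1 (m*1/m≈1 r) p q)) ⟩
    δ p q * x - (h * (h * R i j + u) + s * (- (h * u) * δ i j))
      ≈⟨ +-congʳ (*-congʳ (trans (sym (*-identityˡ _)) (*-congʳ (sym 2h≈1)))) ⟩
    fromℕ 2 * h * δ p q * x - (h * (h * R i j + u) + s * (- (h * u) * δ i j))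
      ≈⟨ +-congʳ (solve 4 (λ t h d x → t :* h :* d :* x := h :* (t :* d) :* x) refl (fromℕ 2) h (δ p q) x) ⟩
    h * (fromℕ 2 * δ p q) * x - (h * (h * R i j + u) + s * (- (h * u) * δ i j))
      ≈⟨ +-congʳ (*-congʳ (*-congˡ (2δ p q))) ⟩
    h * (δ i j + s * δ i j) * x - (h * (h * R i j + u) + s * (- (h * u) * δ i j))
      ≈⟨ solve 6 (λ h d s x w u →
           h :* (d :+ s :* d) :* x :- (h :* (w :+ u) :+ s :* (:- (h :* u) :* d))
           := h :* (d :* x :- (w :+ u)) :+ s :* (h :* (x :+ u) :* d)) refl h (δ i j) s x (h * R i j) u ⟩
    T U (v · δ) p q  ∎
    where
    i = base p
    j = base q
    s = σ p * σ q

  -- The factor of the characteristic polynomial from the vectors (w , -w).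
  antisymmetric : v + v ≈ x - - u
  antisymmetric = begin
    h * (x + u) + h * (x + u)
      ≈⟨ solve 3 (λ h x u → h :* (x :+ u) :+ h :* (x :+ u) := con (+ 2) :* h :* (x :- :- u)) refl h x u ⟩
    fromℕ 2 * h * (x - - u)    ≈⟨ trans (*-congʳ 2h≈1) (*-identityˡ _) ⟩
    x - - u                    ∎

  half : ∀ y → h * (fromℕ 2 * x - y) ≈ x - y / 2
  half y = begin
    h * (fromℕ 2 * x - y)
      ≈⟨ solve 3 (λ h x y → h :* (con (+ 2) :* x :- y) := con (+ 2) :* h :* x :- y :* h) refl h x y ⟩
    fromℕ 2 * h * x - y * h    ≈⟨ +-cong (trans (*-congʳ 2h≈1) (*-identityˡ x)) (-‿cong (sym (/≈* y 2))) ⟩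
    x - y / 2                  ∎

  -- The factor from the vectors (w , w).
  symmetric : det (λ i j → U i j + U i j) ≈ product (λ i → x - evenPart i)
  symmetric = begin
    det (λ i j → U i j + U i j)
      ≈⟨ det-cong {A = λ i j → U i j + U i j} {B = λ i j → h * (charMatrix (fromℕ 2 * x) i j - fromℕ 2 * u)} doubled ⟩
    det (λ i j → h * (charMatrix (fromℕ 2 * x) i j - fromℕ 2 * u))
      ≈⟨ det-scaleRows (replicate n h) (λ i j → charMatrix (fromℕ 2 * x) i j - fromℕ 2 * u) ⟩
    product (replicate n h) * det (λ i j → charMatrix (fromℕ 2 * x) i j - fromℕ 2 * u)
      ≈⟨ *-congˡ (det-shift (fromℕ 2 * x) (fromℕ 2 * u)) ⟩
    h * P * ((fromℕ 2 * x - head ρ - fromℕ n * (fromℕ 2 * u)) * Q)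
      ≈⟨ solve 4 (λ h p y q → h :* p :* (y :* q) := h :* y :* (p :* q)) refl h P (fromℕ 2 * x - head ρ - fromℕ n * (fromℕ 2 * u)) Q ⟩
    h * (fromℕ 2 * x - head ρ - fromℕ n * (fromℕ 2 * u)) * (P * Q)
      ≈⟨ *-cong first (trans (sym (product-distrib-* (replicate (suc m) h) (λ i → fromℕ 2 * x - ρ (suc i))))
                             (product-cong λ i → half (ρ (suc i)))) ⟩
    (x - evenPart zero) * product (λ i → x - evenPart (suc i))  ∎
    where
    P Q : Carrier
    P = product (replicate (suc m) h)
    Q = product (λ i → fromℕ 2 * x - ρ (suc i))

    doubled : (λ i j → U i j + U i j) ≋ (λ i j → h * (charMatrix (fromℕ 2 * x) i j - fromℕ 2 * u))
    doubled i j = begin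
      U i j + U i j
        ≈⟨ solve 5 (λ h d x w u → h :* (d :* x :- (h :* w :+ u)) :+ h :* (d :* x :- (h :* w :+ u))
             := h :* (d :* (con (+ 2) :* x) :- con (+ 2) :* h :* w :- con (+ 2) :* u)) refl h (δ i j) x (R i j) u ⟩
      h * (δ i j * (fromℕ 2 * x) - fromℕ 2 * h * R i j - fromℕ 2 * u)
        ≈⟨ *-congˡ (+-congʳ (+-cong (sym (diagonal≈ (λ _ → fromℕ 2 * x) i j)) (-‿cong (trans (*-congʳ 2h≈1) (*-identityˡ _))))) ⟩
      h * (charMatrix (fromℕ 2 * x) i j - fromℕ 2 * u)  ∎

    first : h * (fromℕ 2 * x - head ρ - fromℕ n * (fromℕ 2 * u)) ≈ x - evenPart zero
    first = begin
      h * (fromℕ 2 * x - head ρ - fromℕ n * (fromℕ 2 * u))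
        ≈⟨ solve 5 (λ h t y n u → h :* (y :- n :* (t :* u)) := h :* y :- (t :* h) :* (n :* u)) refl
             h (fromℕ 2) (fromℕ 2 * x - head ρ) (fromℕ n) u ⟩
      h * (fromℕ 2 * x - head ρ) - fromℕ 2 * h * (fromℕ n * u)
        ≈⟨ +-cong (half (head ρ)) (-‿cong (trans (*-congʳ 2h≈1) (trans (*-identityˡ _) (sym (/≈* (fromℕ n) r))))) ⟩
      x - head ρ / 2 - fromℕ n / r
        ≈⟨ solve 3 (λ x a b → x :- a :- b := x :- (a :+ b)) refl x (head ρ / 2) (fromℕ n / r) ⟩
      x - evenPart zero  ∎
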